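{- Let $n\ge 3$ and $1\le t\le \frac n2$ be integers. The generalized Petersen graph $P(n,t)$ is $(1,3)$-choosable.
   Context: The generalized Petersen graph $P(n,t)$ is the simple graph with vertex set $\{u_i,v_i:1\le i\le n\}$ and edge set $\{u_iu_{i+1},\,u_iv_i,\,v_iv_{i+t}: 1\le i\le n\}$, indices taken modulo $n$. A total weighting of a graph $G$ is a map $\phi:V(G)\cup E(G)\to\mathbb{R}$; the vertex-sum of $v$ is $S_\phi(v)=\phi(v)+\sum_{e\in E(v)}\phi(e)$, where $E(v)$ is the set of edges incident to $v$. It is proper if $S_\phi(u)\ne S_\phi(v)$ for every edge $uv$. A graph $G$ is $(k,k')$-choosable if for every assignment $L$ giving each vertex $x$ a set $L(x)$ of $k$ real numbers and each edge $e$ a set $L(e)$ of $k'$ real numbers, there is a proper total weighting $\phi$ with $\phi(y)\in L(y)$ for all $y\in V(G)\cup E(G)$. -}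

module Defs where

open import Level using (0ℓ)
open import Data.Nat as ℕ using (ℕ; zero; suc; _%_; _≡ᵇ_; _<ᵇ_)
open import Data.Nat.DivMod using (m%n<n)
open import Data.Bool using (Bool; true; false; _∨_; not; if_then_else_)
open import Data.Fin using (Fin; toℕ; fromℕ<)
open import Data.Fin.Properties as FinP using ()
open import Data.List using (List; []; _∷_; map; _++_; filter; foldr; allFin)
open import Data.Product using (_×_; _,_; ∃; proj₁; proj₂)
open import Data.List.Membership.Propositional using (_∈_)
open import Data.Sum using (_⊎_)
open import Relation.Nullary using (¬_; Dec; yes; no)
open import Relation.Nullary.Decidable using (_⊎-dec_)
open import Relation.Binary using (Trichotomous)
open import Relation.Binary.PropositionalEquality using (_≡_; _≢_; refl)

record CompleteOrderedField : Set₁ where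
  infixl 6 _+_
  infixl 7 _*_
  infix 4 _<_ _≤_
  field
    Carrier : Set
    0# 1#   : Carrier
    _+_ _*_ : Carrier → Carrier → Carrier
    -_      : Carrier → Carrier
    _<_     : Carrier → Carrier → Set
    +-assoc     : ∀ x y z → (x + y) + z ≡ x + (y + z)
    +-comm      : ∀ x y → x + y ≡ y + x
    +-identityˡ : ∀ x → 0# + x ≡ x
    +-inverseˡ  : ∀ x → (- x) + x ≡ 0#
    *-assoc     : ∀ x y z → (x * y) * z ≡ x * (y * z)
    *-comm      : ∀ x y → x * y ≡ y * x
    *-identityˡ : ∀ x → 1# * x ≡ x
    distribˡ    : ∀ x y z → x * (y + z) ≡ x * y + x * z
    0≢1         : 0# ≢ 1#
    *-inverse   : ∀ x → x ≢ 0# → ∃ λ y → y * x ≡ 1#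
    <-trans     : ∀ {x y z} → x < y → y < z → x < z
    <-cmp       : Trichotomous _≡_ _<_
    +-mono-<    : ∀ {x y} z → x < y → x + z < y + z
    *-pos       : ∀ {x y} → 0# < x → 0# < y → 0# < x * y

  _≤_ : Carrier → Carrier → Set
  x ≤ y = x < y ⊎ x ≡ y

  field
    complete : (P : Carrier → Set) → ∃ P → (∃ λ b → ∀ x → P x → x ≤ b) →
               ∃ λ s → (∀ x → P x → x ≤ s) × (∀ b → (∀ x → P x → x ≤ b) → s ≤ b)

-- Vertices: (false , i) is u_i and (true , i) is v_i  (i ∈ Z_n).
Vertex : ℕ → Set
Vertex n = Bool × Fin n

shift : ∀ {n} → ℕ → Fin n → Fin n
shift {suc m} k i = fromℕ< (m%n<n (toℕ i ℕ.+ k) (suc m))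

data Edge (n : ℕ) : Set where
  outer spoke inner : Fin n → Edge n

endpoints : ∀ {n} → ℕ → Edge n → Vertex n × Vertex n
endpoints t (outer i) = (false , i) , (false , shift 1 i)
endpoints t (spoke i) = (false , i) , (true , i)
endpoints t (inner i) = (true , i) , (true , shift t i)

-- When 2t = n the pairs v_i v_{i+t} and v_{i+t} v_i coincide; in the simple
-- graph this is one edge, so we keep only the representative with i < t.
innerKept : (n t : ℕ) → Fin n → Bool
innerKept n t i = not ((t ℕ.+ t) ≡ᵇ n) ∨ (toℕ i <ᵇ t)

-- The edge set of P(n,t), each edge listed exactly once (for n ≥ 3, 1 ≤ t ≤ n/2).
edges : (n t : ℕ) → List (Edge n)
edges n t = map outer (allFin n) ++ map spoke (allFin n)
            ++ map inner (filter (λ i → innerKept n t i Data.Bool.≟ true) (allFin n))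

_≟V_ : ∀ {n} (x y : Vertex n) → Dec (x ≡ y)
(a , i) ≟V (b , j) with a Data.Bool.≟ b | i FinP.≟ j
... | yes refl | yes refl = yes refl
... | no ne    | _        = no λ { refl → ne refl }
... | yes _    | no ne    = no λ { refl → ne refl }

incident? : ∀ {n} (t : ℕ) (x : Vertex n) (e : Edge n) →
            Dec (x ≡ proj₁ (endpoints t e) ⊎ x ≡ proj₂ (endpoints t e))
incident? t x e = (x ≟V proj₁ (endpoints t e)) ⊎-dec (x ≟V proj₂ (endpoints t e))

module _ (R : CompleteOrderedField) where
  open CompleteOrderedField R

  vertexSum : (n t : ℕ) → (Vertex n → Carrier) → (Edge n → Carrier) → Vertex n → Carrier
  vertexSum n t φV φE x =
    φV x + foldr _+_ 0# (map φE (filter (incident? t x) (edges n t)))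

  record ThreeSet : Set where
    field
      a b c : Carrier
      a≢b : a ≢ b
      a≢c : a ≢ c
      b≢c : b ≢ c

  _∈3_ : Carrier → ThreeSet → Set
  x ∈3 L = x ≡ ThreeSet.a L ⊎ x ≡ ThreeSet.b L ⊎ x ≡ ThreeSet.c L

  -- P(n,t) is (1,3)-choosable: every vertex list has one element (so φ(x) is
  -- forced to be that element, given by LV x), every edge list has 3 elements.
  Choosable13 : (n t : ℕ) → Set
  Choosable13 n t =
    (LV : Vertex n → Carrier) (LE : Edge n → ThreeSet) →
    ∃ λ (φE : Edge n → Carrier) →
      (∀ e → e ∈ edges n t → φE e ∈3 LE e) ×
      (∀ e → e ∈ edges n t →
         vertexSum n t LV φE (proj₁ (endpoints t e)) ≢ vertexSum n t LV φE (proj₂ (endpoints t e)))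

{-# OPTIONS --safe #-}

-- Write oᵢ, sᵢ, rᵢ for the weights of uᵢuᵢ₊₁, uᵢvᵢ, vᵢvᵢ₊ₜ.  The condition attached to an edge xy
-- is D ≠ 0 for D = S(x) − S(y), which is affine in every weight; the coefficient of a weight is
-- nonzero exactly when its edge meets one of x, y but not both.  So a condition excludes at most
-- one value of the last chosen weight it depends on, and a weight with a three-element list can
-- take care of two conditions.
--
-- If n = 2t, choosing all s, then all o, then all r works: sⱼ takes the condition of the inner
-- edge at vⱼ, oⱼ those of its two outer neighbours, and rⱼ those of its two spokes.
--
-- If n ≠ 2t, order the weights as r, then s except s₀, then o₁, …, oₙ₋₁, o₀, then s₀.  With three
-- exceptions each condition can be charged to its last weight so that no weight is charged more
-- than twice: the two inner edges at v₀ (last weight s₀) and the spoke at u₁ (last weight o₀).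
-- These three are settled before the last weight is chosen.  A condition with last weight z is
-- vacuous in z if the value of z it excludes is not in the list of z.  If x, y are earlier weights
-- in the condition, any two values of x and the three values of y exclude at least 4 > 3 values
-- of z, so all but at most one value of x leave a value of y making the condition vacuous.  The
-- pairs (x, y) are (r₀, s₋ₜ), (r₁, o₁) and (r₋ₜ, sₜ).  When n = 3t the weights sₜ and s₋ₜ are also
-- in conflict with each other, but the last pair has five sums against four forbidden values.
module Submission where

open import Defs
open import Level using (0ℓ)
open import Algebra.Bundles using (AbelianGroup)
import Algebra.Consequences.Propositional as Consequences
import Algebra.Properties.AbelianGroup as AbelianGroupProperties
import Algebra.Properties.CommutativeSemigroup as CommutativeSemigroupProperties
open import Data.Bool using (Bool; true; false; if_then_else_; not; _∨_)
import Data.Bool.Properties as Bool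
open import Data.Fin as Fin using (Fin; zero; suc; toℕ)
import Data.Fin.Properties as Fin
open import Data.List using (List; []; _∷_; map; _++_; filter; foldr; allFin; length; lookup)
open import Data.List.Membership.Propositional using (_∈_; _∉_; find; lose)
import Data.List.Membership.DecPropositional as DecMembership
open import Data.List.Membership.Propositional.Properties
  using (∈-lookup; ∈-map⁺; ∈-map⁻; ∈-++⁺ˡ; ∈-++⁺ʳ; ∈-++⁻; ∈-filter⁺; ∈-filter⁻; ∈-allFin)
open import Data.List.Relation.Unary.All as All using (All; []; _∷_)
import Data.List.Relation.Unary.All.Properties as All
open import Data.List.Relation.Unary.AllPairs using (AllPairs; []; _∷_)
import Data.List.Relation.Unary.AllPairs.Properties as AllPairs
open import Data.List.Relation.Unary.Any as Any using (Any; here; there)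
open import Data.List.Relation.Unary.Any.Properties using (lookup-index)
open import Data.List.Relation.Unary.Linked using (Linked; [-]; _∷_)
open import Data.List.Relation.Unary.Linked.Properties using (Linked⇒AllPairs)
open import Data.List.Relation.Unary.Unique.Propositional using (Unique)
import Data.List.Relation.Unary.Unique.Propositional.Properties as Unique
open import Data.Nat as ℕ using (ℕ; zero; suc; s≤s; z≤n; _%_)
open import Data.Nat.DivMod
  using (m%n<n; m<n⇒m%n≡m; m≤n⇒[n∸m]%m≡n%m; %-distribˡ-+; m%n%n≡m%n; [m+n]%n≡m%n)
import Data.Nat.Properties as ℕ
open import Data.Product using (_×_; _,_; ∃; proj₁; proj₂)
open import Data.Sum as Sum using (_⊎_; inj₁; inj₂; [_,_]′)
open import Function using (_∘_; id; Equivalence)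
open import Relation.Binary using (tri<; tri≈; tri>; DecidableEquality)
open import Relation.Binary.PropositionalEquality
open import Relation.Nullary using (¬_; Dec; yes; no; contradiction)
open import Relation.Nullary.Decidable
  using (does; ¬?; decidable-stable; map′; dec-true; dec-false)

-- Signs and arithmetic in an ordered field.

data Coefficient : Set where
  minus none plus : Coefficient

none? : (c : Coefficient) → Dec (c ≡ none)
none? minus = no λ ()
none? none  = yes refl
none? plus  = no λ ()

negate : Coefficient → Coefficient
negate minus = plus
negate none  = none
negate plus  = minus

module OrderedField (R : CompleteOrderedField) where
  open CompleteOrderedField R

  +-abelianGroup : AbelianGroup 0ℓ 0ℓ
  +-abelianGroup = record
    { Carrier = Carrier ; _≈_ = _≡_ ; _∙_ = _+_ ; ε = 0# ; _⁻¹ = -_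
    ; isAbelianGroup = record
      { isGroup = record
        { isMonoid = record
          { isSemigroup = record
            { isMagma = record { isEquivalence = isEquivalence ; ∙-cong = cong₂ _+_ }
            ; assoc = +-assoc }
          ; identity = Consequences.comm∧idˡ⇒id +-comm +-identityˡ }
        ; inverse = Consequences.comm∧invˡ⇒inv +-comm +-inverseˡ
        ; ⁻¹-cong = cong -_ }
      ; comm = +-comm } }

  open AbelianGroup +-abelianGroup public
    using ()
    renaming ( _-_ to infixl 6 _-_ ; identityʳ to +-identityʳ ; inverseʳ to +-inverseʳ
             ; commutativeSemigroup to +-commutativeSemigroup )
  open AbelianGroupProperties +-abelianGroup public
    using ( ⁻¹-∙-comm; ⁻¹-injective; ⁻¹-involutive; ε⁻¹≈ε; ∙-cancelˡ; ∙-cancelʳ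
          ; inverseˡ-unique; inverseʳ-unique; xyx⁻¹≈y )
  open CommutativeSemigroupProperties +-commutativeSemigroup public
    using (interchange; xy∙z≈xz∙y)

  _≟_ : DecidableEquality Carrier
  x ≟ y with <-cmp x y
  ... | tri< _ x≢y _ = no x≢y
  ... | tri≈ _ x≡y _ = yes x≡y
  ... | tri> _ x≢y _ = no x≢y

  <⇒≢ : ∀ {x y} → x < y → x ≢ y
  <⇒≢ {x} {y} x<y x≡y with <-cmp x y
  ... | tri< _ x≢y _ = x≢y x≡y
  ... | tri≈ x≮y _ _ = x≮y x<y
  ... | tri> x≮y _ _ = x≮y x<y

  +-monoʳ-< : ∀ z {x y} → x < y → z + x < z + y
  +-monoʳ-< z {x} {y} x<y = subst₂ _<_ (+-comm x z) (+-comm y z) (+-mono-< z x<y)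

  x-y≡0⇒x≡y : ∀ {x y} → x - y ≡ 0# → x ≡ y
  x-y≡0⇒x≡y {x} {y} eq = trans (inverseˡ-unique x (- y) eq) (⁻¹-involutive y)

  [x+z]-[y+z]≡x-y : ∀ x y z → (x + z) - (y + z) ≡ x - y
  [x+z]-[y+z]≡x-y x y z = begin
    (x + z) + - (y + z)    ≡⟨ cong (x + z +_) (⁻¹-∙-comm y z) ⟨
    (x + z) + (- y + - z)  ≡⟨ interchange x z (- y) (- z) ⟩
    (x - y) + (z - z)      ≡⟨ cong (x - y +_) (+-inverseʳ z) ⟩
    (x - y) + 0#           ≡⟨ +-identityʳ (x - y) ⟩
    x - y                  ∎
    where open ≡-Reasoning

  [x-y]+[z-x]≡z-y : ∀ x y z → (x - y) + (z - x) ≡ z - y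
  [x-y]+[z-x]≡z-y x y z = begin
    (x - y) + (z - x)    ≡⟨ interchange x (- y) z (- x) ⟩
    (x + z) + (- y - x)  ≡⟨ cong₂ _+_ (+-comm x z) (⁻¹-∙-comm y x) ⟩
    (z + x) - (y + x)    ≡⟨ [x+z]-[y+z]≡x-y z y x ⟩
    z - y                ∎
    where open ≡-Reasoning

  infixl 7 _·_

  _·_ : Coefficient → Carrier → Carrier
  minus · x = - x
  none  · x = 0#
  plus  · x = x

  ·-distribˡ-+ : ∀ c x y → c · (x + y) ≡ c · x + c · y
  ·-distribˡ-+ minus x y = sym (⁻¹-∙-comm x y)
  ·-distribˡ-+ none  x y = sym (+-identityˡ 0#)
  ·-distribˡ-+ plus  x y = refl

  ·-zeroʳ : ∀ c → c · 0# ≡ 0#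
  ·-zeroʳ minus = ε⁻¹≈ε
  ·-zeroʳ none  = refl
  ·-zeroʳ plus  = refl

  ·-negate : ∀ c x → negate c · x ≡ - (c · x)
  ·-negate minus x = sym (⁻¹-involutive x)
  ·-negate none  x = sym ε⁻¹≈ε
  ·-negate plus  x = refl

  ·-injective : ∀ {c} → c ≢ none → ∀ {x y} → c · x ≡ c · y → x ≡ y
  ·-injective {minus} c≢none = ⁻¹-injective
  ·-injective {none}  c≢none = contradiction refl c≢none
  ·-injective {plus}  c≢none = id

  ·[-]-injective : ∀ {c} → c ≢ none → ∀ z {x y} → c · (x - z) ≡ c · (y - z) → x ≡ y
  ·[-]-injective c≢none z {x} {y} = ∙-cancelʳ (- z) x y ∘ ·-injective c≢none

  ·-telescope : ∀ c x y z → c · (x - y) + c · (z - x) ≡ c · (z - y)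
  ·-telescope c x y z =
    trans (sym (·-distribˡ-+ c (x - y) (z - x))) (cong (c ·_) ([x-y]+[z-x]≡z-y x y z))

  -- Pigeonhole for translates and sumsets of three-element sets.

  open DecMembership _≟_ using (_∈?_)

  AllPairs-lookup : ∀ {xs} → AllPairs _<_ xs → ∀ {i j} → i Fin.< j → lookup xs i < lookup xs j
  AllPairs-lookup (x<xs ∷ _) {zero}  {suc j} _ = All.lookup x<xs (∈-lookup j)
  AllPairs-lookup (_ ∷ xs<)  {suc i} {suc j} (s≤s i<j) = AllPairs-lookup xs< i<j

  -- Pigeonhole: if every entry of `xs` lay in `ys`, two positions of `xs` would share an index in
  -- `ys` and so carry equal entries, which strict monotonicity forbids.
  escape : ∀ {xs} ys → Linked _<_ xs → length ys ℕ.< length xs → ∃ λ x → x ∈ xs × x ∉ ys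
  escape {xs} ys xs< ys<xs with Any.any? (¬? ∘ (_∈? ys)) xs
  ... | yes some = find some
  ... | no  ∄∉ys = contradiction
    (trans (lookup-index (all∈ i)) (trans (cong (lookup ys) same) (sym (lookup-index (all∈ j)))))
    (<⇒≢ (AllPairs-lookup (Linked⇒AllPairs <-trans xs<) i<j))
    where
    all∈ : ∀ i → lookup xs i ∈ ys
    all∈ i = decidable-stable (lookup xs i ∈? ys)
      (λ ∉ys → ∄∉ys (lose (∈-lookup i) ∉ys))
    clash = Fin.pigeonhole ys<xs (λ i → Any.index (all∈ i))
    i = proj₁ clash
    j = proj₁ (proj₂ clash)
    i<j = proj₁ (proj₂ (proj₂ clash))
    same = proj₂ (proj₂ (proj₂ clash))

  infix 4 _∈₃_

  _∈₃_ : Carrier → ThreeSet R → Set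
  _∈₃_ = _∈3_ R

  increasing : (A : ThreeSet R) → ∃ λ x → ∃ λ y → ∃ λ z →
               (x ∈₃ A × y ∈₃ A × z ∈₃ A) × (x < y × y < z)
  increasing A with <-cmp a b | <-cmp b c | <-cmp a c
    where open ThreeSet A
  ... | tri≈ _ a≡b _ | _ | _ = contradiction a≡b (ThreeSet.a≢b A)
  ... | _ | tri≈ _ b≡c _ | _ = contradiction b≡c (ThreeSet.b≢c A)
  ... | _ | _ | tri≈ _ a≡c _ = contradiction a≡c (ThreeSet.a≢c A)
  ... | tri< a<b _ _ | tri< b<c _ _ | _ =
    _ , _ , _ , (inj₁ refl , inj₂ (inj₁ refl) , inj₂ (inj₂ refl)) , a<b , b<c
  ... | tri< a<b _ _ | tri> _ _ c<b | tri< a<c _ _ =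
    _ , _ , _ , (inj₁ refl , inj₂ (inj₂ refl) , inj₂ (inj₁ refl)) , a<c , c<b
  ... | tri< a<b _ _ | tri> _ _ c<b | tri> _ _ c<a =
    _ , _ , _ , (inj₂ (inj₂ refl) , inj₁ refl , inj₂ (inj₁ refl)) , c<a , a<b
  ... | tri> _ _ b<a | tri< b<c _ _ | tri< a<c _ _ =
    _ , _ , _ , (inj₂ (inj₁ refl) , inj₁ refl , inj₂ (inj₂ refl)) , b<a , a<c
  ... | tri> _ _ b<a | tri< b<c _ _ | tri> _ _ c<a =
    _ , _ , _ , (inj₂ (inj₁ refl) , inj₂ (inj₂ refl) , inj₁ refl) , b<c , c<a
  ... | tri> _ _ b<a | tri> _ _ c<b | _ =
    _ , _ , _ , (inj₂ (inj₂ refl) , inj₂ (inj₁ refl) , inj₁ refl) , c<b , b<a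

  image : (f : Carrier → Carrier) → (∀ {x y} → f x ≡ f y → x ≡ y) → ThreeSet R → ThreeSet R
  image f f-inj A = record
    { a = f a ; b = f b ; c = f c ; a≢b = a≢b ∘ f-inj ; a≢c = a≢c ∘ f-inj ; b≢c = b≢c ∘ f-inj }
    where open ThreeSet A

  image⁻ : ∀ f (f-inj : ∀ {x y} → f x ≡ f y → x ≡ y) A {y} → y ∈₃ image f f-inj A →
           ∃ λ x → x ∈₃ A × y ≡ f x
  image⁻ f _ A (inj₁ y≡)        = _ , inj₁ refl , y≡
  image⁻ f _ A (inj₂ (inj₁ y≡)) = _ , inj₂ (inj₁ refl) , y≡
  image⁻ f _ A (inj₂ (inj₂ y≡)) = _ , inj₂ (inj₂ refl) , y≡

  values : (Carrier → Carrier) → ThreeSet R → List Carrier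
  values f A = f a ∷ f b ∷ f c ∷ []
    where open ThreeSet A

  ∈-values : ∀ f {A x} → x ∈₃ A → f x ∈ values f A
  ∈-values f (inj₁ refl)        = here refl
  ∈-values f (inj₂ (inj₁ refl)) = there (here refl)
  ∈-values f (inj₂ (inj₂ refl)) = there (there (here refl))

  -- With `A` sorted as `x < y < z`, the chain `T + x < T + y < T + z < T′ + z` has four members,
  -- one more than `ys` can cover.
  translates-escape-< : ∀ A {T T′} → T < T′ → ∀ ys → length ys ℕ.≤ 3 →
    (∃ λ x → x ∈₃ A × T + x ∉ ys) ⊎ (∃ λ x → x ∈₃ A × T′ + x ∉ ys)
  translates-escape-< A {T} {T′} T<T′ ys ys≤3
    with x , y , z , (x∈ , y∈ , z∈) , x<y , y<z ← increasing A
    with escape ys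
           (+-monoʳ-< T x<y ∷ +-monoʳ-< T y<z ∷ +-mono-< z T<T′ ∷ [-]) (s≤s ys≤3)
  ... | _ , here refl , ∉ys = inj₁ (x , x∈ , ∉ys)
  ... | _ , there (here refl) , ∉ys = inj₁ (y , y∈ , ∉ys)
  ... | _ , there (there (here refl)) , ∉ys = inj₁ (z , z∈ , ∉ys)
  ... | _ , there (there (there (here refl))) , ∉ys = inj₂ (z , z∈ , ∉ys)

  translates-escape : ∀ A {T T′} → T ≢ T′ → ∀ ys → length ys ℕ.≤ 3 →
    (∃ λ x → x ∈₃ A × T + x ∉ ys) ⊎ (∃ λ x → x ∈₃ A × T′ + x ∉ ys)
  translates-escape A {T} {T′} T≢T′ ys ys≤3 with <-cmp T T′
  ... | tri< T<T′ _ _ = translates-escape-< A T<T′ ys ys≤3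
  ... | tri≈ _ T≡T′ _ = contradiction T≡T′ T≢T′
  ... | tri> _ _ T′<T = Sum.swap (translates-escape-< A T′<T ys ys≤3)

  -- A monotone path through the grid of sums: with both sets sorted,
  -- `x + u < x + v < x + w < y + w < z + w` gives five values.
  sumset-escape : ∀ A B ys → length ys ℕ.≤ 4 →
    ∃ λ x → ∃ λ y → x ∈₃ A × y ∈₃ B × x + y ∉ ys
  sumset-escape A B ys ys≤4
    with x , y , z , (x∈ , y∈ , z∈) , x<y , y<z ← increasing A
    with u , v , w , (u∈ , v∈ , w∈) , u<v , v<w ← increasing B
    with escape ys
           (+-monoʳ-< x u<v ∷ +-monoʳ-< x v<w ∷ +-mono-< w x<y ∷ +-mono-< w y<z ∷ [-]) (s≤s ys≤4)
  ... | _ , here refl , ∉ys = x , u , x∈ , u∈ , ∉ys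
  ... | _ , there (here refl) , ∉ys = x , v , x∈ , v∈ , ∉ys
  ... | _ , there (there (here refl)) , ∉ys = x , w , x∈ , w∈ , ∉ys
  ... | _ , there (there (there (here refl))) , ∉ys = y , w , y∈ , w∈ , ∉ys
  ... | _ , there (there (there (there (here refl)))) , ∉ys = z , w , z∈ , w∈ , ∉ys

-- Assignments and choices from lists.

module ListChoice
  (R : CompleteOrderedField) {X : Set} (_≟ₓ_ : DecidableEquality X) (L : X → ThreeSet R)
  where
  open CompleteOrderedField R
  open OrderedField R

  Assignment : Set
  Assignment = X → Carrier

  infixl 8 _[_≔_]

  _[_≔_] : Assignment → X → Carrier → Assignment
  (φ [ x ≔ v ]) y = if does (y ≟ₓ x) then v else φ y

  update-same : ∀ φ x v → (φ [ x ≔ v ]) x ≡ v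
  update-same φ x v with x ≟ₓ x
  ... | yes _   = refl
  ... | no  x≢x = contradiction refl x≢x

  update-other : ∀ φ {x} v {y} → y ≢ x → (φ [ x ≔ v ]) y ≡ φ y
  update-other φ {x} v {y} y≢x with y ≟ₓ x
  ... | yes y≡x = contradiction y≡x y≢x
  ... | no  _   = refl

  Legal : Assignment → Set
  Legal φ = ∀ x → φ x ∈₃ L x

  legal-update : ∀ {φ x v} → Legal φ → v ∈₃ L x → Legal (φ [ x ≔ v ])
  legal-update {φ} {x} {v} legal v∈ y with y ≟ₓ x
  ... | yes refl = v∈
  ... | no  _    = legal y

  Indep : (Assignment → Set) → X → Set
  Indep P x = ∀ φ v → P φ → P (φ [ x ≔ v ])

  -- At most one value at `x` makes `P` fail, phrased through pairs of values.
  Flex : (Assignment → Set) → X → Set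
  Flex P x = ∀ φ {v w} → v ≢ w → P (φ [ x ≔ v ]) ⊎ P (φ [ x ≔ w ])

  -- Each condition rejects at most one of the three list values, so some value passes both.
  choose : ∀ {P Q x} → Flex P x → Flex Q x → ∀ φ →
           ∃ λ v → v ∈₃ L x × P (φ [ x ≔ v ]) × Q (φ [ x ≔ v ])
  choose {P} {Q} {x} P-flex Q-flex φ
    with P-flex φ a≢b | P-flex φ a≢c | P-flex φ b≢c | Q-flex φ a≢b | Q-flex φ a≢c | Q-flex φ b≢c
    where open ThreeSet (L x)
  ... | inj₁ pa | _ | _ | inj₁ qa | _ | _ = _ , inj₁ refl , pa , qa
  ... | inj₁ pa | _ | _ | inj₂ qb | inj₁ qa | _ = _ , inj₁ refl , pa , qa
  ... | inj₁ pa | _ | inj₁ pb | inj₂ qb | inj₂ qc | _ = _ , inj₂ (inj₁ refl) , pb , qb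
  ... | inj₁ pa | _ | inj₂ pc | inj₂ qb | inj₂ qc | _ = _ , inj₂ (inj₂ refl) , pc , qc
  ... | inj₂ pb | _ | _ | inj₂ qb | _ | _ = _ , inj₂ (inj₁ refl) , pb , qb
  ... | inj₂ pb | _ | _ | inj₁ qa | _ | inj₁ qb = _ , inj₂ (inj₁ refl) , pb , qb
  ... | inj₂ pb | inj₁ pa | _ | inj₁ qa | _ | inj₂ qc = _ , inj₁ refl , pa , qa
  ... | inj₂ pb | inj₂ pc | _ | inj₁ qa | _ | inj₂ qc = _ , inj₂ (inj₂ refl) , pc , qc

  -- If `P` ignores `y`, settle `P` at `x` and then `Q` at `y`; if `P` is flexible at `y`, one
  -- choice at `y` serves both.
  choose-both : ∀ {P Q x y} → Flex P x → Indep P y ⊎ Flex P y → Flex Q y → ∀ {φ} → Legal φ →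
                ∃ λ ψ → Legal ψ × P ψ × Q ψ
  choose-both {P} {Q} Px (inj₁ P-indep) Qy {φ} legal
    with u , u∈ , pu , _ ← choose {P} {P} Px Px φ
    with v , v∈ , qv , _ ← choose {Q} {Q} Qy Qy (φ [ _ ≔ u ])
    = _ , legal-update (legal-update legal u∈) v∈ , P-indep _ v pu , qv
  choose-both {P} {Q} Px (inj₂ Py) Qy {φ} legal
    with v , v∈ , pv , qv ← choose {P} {Q} Py Qy φ
    = _ , legal-update legal v∈ , pv , qv

  -- Conditions that are affine in each weight.

  module Affine
    {E : Set} (D : E → Assignment → Carrier) (ε : E → X → Coefficient)
    (D-update : ∀ e φ x v → D e (φ [ x ≔ v ]) ≡ D e φ + ε e x · (v - φ x))
    where

    Sat : E → Assignment → Set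
    Sat e φ = D e φ ≢ 0#

    D-none : ∀ {e x} → ε e x ≡ none → ∀ φ v → D e (φ [ x ≔ v ]) ≡ D e φ
    D-none {e} {x} ε≡none φ v =
      trans (D-update e φ x v)
        (trans (cong (λ c → D e φ + c · (v - φ x)) ε≡none) (+-identityʳ (D e φ)))

    D-injective : ∀ {e x} → ε e x ≢ none → ∀ φ {v w} →
                  D e (φ [ x ≔ v ]) ≡ D e (φ [ x ≔ w ]) → v ≡ w
    D-injective {e} {x} ε≢none φ {v} {w} eq = ·[-]-injective ε≢none (φ x)
      (∙-cancelˡ (D e φ) _ _ (trans (sym (D-update e φ x v)) (trans eq (D-update e φ x w))))

    sat-indep : ∀ {e x} → ε e x ≡ none → Indep (Sat e) x
    sat-indep ε≡none φ v sat eq = sat (trans (sym (D-none ε≡none φ v)) eq)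

    sat-flex : ∀ {e x} → ε e x ≢ none → Flex (Sat e) x
    sat-flex {e} {x} ε≢none φ {v} {w} v≢w with D e (φ [ x ≔ v ]) ≟ 0#
    ... | no  D≢0 = inj₁ D≢0
    ... | yes D≡0 = inj₂ λ D≡0′ → v≢w (D-injective ε≢none φ (trans D≡0 (sym D≡0′)))

    -- The left-hand side is the value of D e after setting z to w.
    Vacuous : E → X → Assignment → Set
    Vacuous e z φ = ∀ {w} → w ∈₃ L z → D e φ + ε e z · (w - φ z) ≢ 0#

    -- The weight of `y` can still be chosen to make `e` vacuous in `z`. Writing this with
    -- increments instead of updated assignments lets a third weight enter through `D e φ` alone.
    Avoidable : E → X → X → Assignment → Set
    Avoidable e y z φ = ∃ λ v → v ∈₃ L y ×
      (∀ {w} → w ∈₃ L z → D e φ + ε e y · (v - φ y) + ε e z · (w - φ z) ≢ 0#)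

    -- The current weight `φ z` is itself an admissible `w`, and its increment vanishes.
    vacuous⇒sat : ∀ {e z φ} → Legal φ → Vacuous e z φ → Sat e φ
    vacuous⇒sat {e} {z} {φ} legal vac D≡0 = vac (legal z)
      (trans (cong₂ _+_ D≡0 (trans (cong (ε e z ·_) (+-inverseʳ (φ z))) (·-zeroʳ (ε e z))))
             (+-identityʳ 0#))

    vacuous-indep : ∀ {e z x} → ε e x ≡ none → Indep (Vacuous e z) x
    vacuous-indep {e} {z} {x} ε≡none φ v vac {w} w∈ eq with z ≟ₓ x
    ... | no  _    = vac w∈ (trans (cong (_+ ε e z · (w - φ z)) (sym (D-none ε≡none φ v))) eq)
    -- If `x` is `z` itself, the coefficient of `z` is zero, so the increments from the old and the
    -- new weight of `z` both vanish.
    ... | yes refl = vac w∈ (begin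
      D e φ + ε e z · (w - φ z)          ≡⟨ cong (λ c → D e φ + c · (w - φ z)) ε≡none ⟩
      D e φ + 0#                         ≡⟨ cong (λ c → D e φ + c · (w - v)) ε≡none ⟨
      D e φ + ε e z · (w - v)            ≡⟨ cong (_+ ε e z · (w - v)) (D-none ε≡none φ v) ⟨
      D e (φ [ z ≔ v ]) + ε e z · (w - v) ≡⟨ eq ⟩
      0#                                 ∎)
      where open ≡-Reasoning

    -- The value of `D e` once `z` is set to `w` does not depend on what `z` held before: the
    -- increments telescope.
    vacuous-indep-self : ∀ {e z} → Indep (Vacuous e z) z
    vacuous-indep-self {e} {z} φ v vac {w} w∈ eq = vac w∈ (begin
      D e φ + ε e z · (w - φ z)
        ≡⟨ cong (D e φ +_) (·-telescope (ε e z) v (φ z) w) ⟨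
      D e φ + (ε e z · (v - φ z) + ε e z · (w - v))
        ≡⟨ +-assoc _ _ _ ⟨
      D e φ + ε e z · (v - φ z) + ε e z · (w - v)
        ≡⟨ cong₂ (λ d u → d + ε e z · (w - u)) (D-update e φ z v) (update-same φ z v) ⟨
      D e (φ [ z ≔ v ]) + ε e z · (w - (φ [ z ≔ v ]) z)
        ≡⟨ eq ⟩
      0# ∎)
      where open ≡-Reasoning

    avoidable-indep : ∀ {e y z x} → ε e x ≡ none → y ≢ x → z ≢ x → Indep (Avoidable e y z) x
    avoidable-indep {e} {y} {z} {x} ε≡none y≢x z≢x φ u (v , v∈ , avoids)
      rewrite D-none ε≡none φ u | update-other φ u y≢x | update-other φ u z≢x = v , v∈ , avoids

    avoidable⇒vacuous : ∀ {e y z φ} → z ≢ y → Avoidable e y z φ →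
                        ∃ λ v → v ∈₃ L y × Vacuous e z (φ [ y ≔ v ])
    avoidable⇒vacuous {e} {y} {z} {φ} z≢y (v , v∈ , avoids) = v , v∈ , λ {w} w∈ eq →
      avoids w∈ (trans (cong₂ (λ d u → d + ε e z · (w - u))
                              (sym (D-update e φ y v)) (sym (update-other φ v z≢y))) eq)

    -- Two values of `x` bring `D e` to two different numbers. Adding the three increments available
    -- at `y` yields at least four values, while the list of `z` excludes at most three.
    avoidable-flex : ∀ {e y z x} → ε e x ≢ none → ε e y ≢ none → y ≢ x → z ≢ x →
                     Flex (Avoidable e y z) x
    avoidable-flex {e} {y} {z} {x} εx εy y≢x z≢x φ {p} {q} p≢q =
      Sum.map (build p) (build q)
        (translates-escape (image step step-inj (L y)) (p≢q ∘ D-injective εx φ) (values hit (L z)) ℕ.≤-refl)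
      where
      -- `step v` is the increment from `y`; `hit w` is the partial sum that setting `z` to `w`
      -- would cancel.
      step hit : Carrier → Carrier
      step v = ε e y · (v - φ y)
      hit w = - (ε e z · (w - φ z))

      step-inj : ∀ {v w} → step v ≡ step w → v ≡ w
      step-inj = ·[-]-injective εy (φ y)

      build : ∀ r → (∃ λ s → s ∈₃ image step step-inj (L y) × D e (φ [ x ≔ r ]) + s ∉ values hit (L z)) →
              Avoidable e y z (φ [ x ≔ r ])
      build r (s , s∈ , ∉hit) with v , v∈ , refl ← image⁻ step step-inj (L y) s∈
        rewrite update-other φ r y≢x | update-other φ r z≢x =
        v , v∈ , λ {w} w∈ eq →
          ∉hit (subst (_∈ values hit (L z)) (sym (inverseˡ-unique _ _ eq)) (∈-values hit {L z} w∈))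

    -- First `y` is set, then `y′`. One independence hypothesis keeps the second condition avoidable
    -- after the first step; the other keeps the first condition vacuous after the second step.
    vacuous-both : ∀ {e y z e′ y′ z′ φ} → z ≢ y → z′ ≢ y′ →
      Indep (Avoidable e′ y′ z′) y → Indep (Vacuous e z) y′ →
      Legal φ → Avoidable e y z φ → Avoidable e′ y′ z′ φ →
      ∃ λ ψ → Legal ψ × Vacuous e z ψ × Vacuous e′ z′ ψ
    vacuous-both z≢y z′≢y′ indep indep′ legal avoid avoid′
      with u , u∈ , vac ← avoidable⇒vacuous z≢y avoid
      with v , v∈ , vac′ ← avoidable⇒vacuous z′≢y′ (indep _ u avoid′)
      = _ , legal-update (legal-update legal u∈) v∈ , indep′ _ v vac , vac′

    vacuous-pair : ∀ {e x y z} → Flex (Avoidable e y z) x → z ≢ y → ∀ φ →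
      ∃ λ u → ∃ λ v → u ∈₃ L x × v ∈₃ L y × Vacuous e z (φ [ x ≔ u ] [ y ≔ v ])
    vacuous-pair {e} {x} {y} {z} flex z≢y φ
      -- Only one condition has to be met at `x`, so it is passed to `choose` twice.
      with u , u∈ , avoid , _ ← choose {Avoidable e y z} {Avoidable e y z} flex flex φ
      with v , v∈ , vac ← avoidable⇒vacuous z≢y avoid
      = u , v , u∈ , v∈ , vac

    -- The nine sums of two three-element lists take at least five values, and only four
    -- of them are excluded: three by the list of z and one by e′.
    vacuous-sat-pair : ∀ {e e′ x y z} → ε e x ≢ none → ε e y ≢ none →
      ε e′ x ≡ negate (ε e x) → ε e′ y ≡ negate (ε e y) → y ≢ x → z ≢ x → z ≢ y → ∀ φ →
      ∃ λ u → ∃ λ v → u ∈₃ L x × v ∈₃ L y ×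
        Vacuous e z (φ [ x ≔ u ] [ y ≔ v ]) × Sat e′ (φ [ x ≔ u ] [ y ≔ v ])
    vacuous-sat-pair {e} {e′} {x} {y} {z} εx εy ε′x ε′y y≢x z≢x z≢y φ
      with _ , _ , s∈ , s′∈ , ∉bad ← sumset-escape
             (image (λ u → ε e x · (u - φ x)) (·[-]-injective εx (φ x)) (L x))
             (image (λ v → ε e y · (v - φ y)) (·[-]-injective εy (φ y)) (L y))
             -- Since `e′` has the opposite signs at `x` and `y`, `D e′` vanishes exactly when the
             -- sum of the two increments is `D e′ φ`. The other three entries are the sums that
             -- some value in the list of `z` would cancel.
             (D e′ φ ∷ values (λ w → - (D e φ + ε e z · (w - φ z))) (L z)) ℕ.≤-refl
      with u , u∈ , refl ← image⁻ (λ u → ε e x · (u - φ x)) (·[-]-injective εx (φ x)) (L x) s∈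
      with v , v∈ , refl ← image⁻ (λ v → ε e y · (v - φ y)) (·[-]-injective εy (φ y)) (L y) s′∈
      = u , v , u∈ , v∈ , vac , sat
      where
      open ≡-Reasoning
      ψ = φ [ x ≔ u ] [ y ≔ v ]
      α = ε e x · (u - φ x)
      β = ε e y · (v - φ y)

      hit : Carrier → Carrier
      hit w = - (D e φ + ε e z · (w - φ z))

      D-ψ : ∀ f → D f ψ ≡ D f φ + (ε f x · (u - φ x) + ε f y · (v - φ y))
      D-ψ f = begin
        D f ψ
          ≡⟨ D-update f (φ [ x ≔ u ]) y v ⟩
        D f (φ [ x ≔ u ]) + ε f y · (v - (φ [ x ≔ u ]) y)
          ≡⟨ cong₂ (λ d b → d + ε f y · (v - b)) (D-update f φ x u) (update-other φ u y≢x) ⟩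
        D f φ + ε f x · (u - φ x) + ε f y · (v - φ y)
          ≡⟨ +-assoc _ _ _ ⟩
        D f φ + (ε f x · (u - φ x) + ε f y · (v - φ y)) ∎

      vac : Vacuous e z ψ
      vac {w} w∈ eq = ∉bad (there (subst (_∈ values hit (L z))
        (sym (inverseʳ-unique _ _ (begin
          (D e φ + ε e z · (w - φ z)) + (α + β)
            ≡⟨ xy∙z≈xz∙y (D e φ) _ _ ⟩
          (D e φ + (α + β)) + ε e z · (w - φ z)
            ≡⟨ cong₂ (λ d c → d + ε e z · (w - c)) (D-ψ e)
                 (trans (update-other (φ [ x ≔ u ]) v z≢y) (update-other φ u z≢x)) ⟨
          D e ψ + ε e z · (w - ψ z)
            ≡⟨ eq ⟩
          0# ∎)))
        (∈-values hit {L z} w∈)))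

      sat : Sat e′ ψ
      sat eq = ∉bad (here (sym (x-y≡0⇒x≡y (begin
        D e′ φ - (α + β)          ≡⟨ cong (D e′ φ +_) (⁻¹-∙-comm α β) ⟨
        D e′ φ + (- α + - β)
          ≡⟨ cong (D e′ φ +_) (cong₂ _+_ (·-negate (ε e x) _) (·-negate (ε e y) _)) ⟨
        D e′ φ + (negate (ε e x) · (u - φ x) + negate (ε e y) · (v - φ y))
          ≡⟨ cong (D e′ φ +_) (cong₂ (λ c d → c · (u - φ x) + d · (v - φ y)) ε′x ε′y) ⟨
        D e′ φ + (ε e′ x · (u - φ x) + ε e′ y · (v - φ y)) ≡⟨ D-ψ e′ ⟨
        D e′ ψ                    ≡⟨ eq ⟩
        0#                        ∎))))

    -- Greedy choice along a schedule.

    module Greedy (f g : X → E) where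

      -- `f x` and `g x` are the two conditions charged to `x`; its value is chosen to satisfy both.
      Absorbs : E → X → Set
      Absorbs e x = e ≡ f x ⊎ e ≡ g x

      -- The choice at `x` cannot spoil `e`: either `e` does not depend on `x`, or `e` is charged to
      -- `x`.
      Kept : E → X → Set
      Kept e x = ε e x ≡ none ⊎ Absorbs e x

      -- Some weight of the list settles `e` and every weight after it keeps `e`; those before it
      -- are unrestricted.
      data Handled (e : E) : List X → Set where
        now   : ∀ {x xs} → Absorbs e x → All (Kept e) xs → Handled e (x ∷ xs)
        later : ∀ {x xs} → Handled e xs → Handled e (x ∷ xs)

      kept∧absorbed⇒handled : ∀ {e xs} → All (Kept e) xs → Any (Absorbs e) xs → Handled e xs
      kept∧absorbed⇒handled (_ ∷ kept) (here absorbs) = now absorbs kept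
      kept∧absorbed⇒handled (_ ∷ kept) (there some)   = later (kept∧absorbed⇒handled kept some)

      handled-++ʳ : ∀ {e} xs {ys} → Handled e ys → Handled e (xs ++ ys)
      handled-++ʳ []       h = h
      handled-++ʳ (_ ∷ xs) h = later (handled-++ʳ xs h)

      -- `preserve` carries properties of the starting assignment through the run without charging
      -- them to a weight, in particular vacuity.
      record Outcome (φ : Assignment) (xs : List X) : Set₁ where
        field
          result   : Assignment
          legal    : Legal result
          handled  : ∀ {e} → Handled e xs → Sat e result
          kept     : ∀ {e} → All (Kept e) xs → Sat e φ → Sat e result
          preserve : ∀ {P} → All (Indep P) xs → P φ → P result

      greedy : ∀ xs → All (λ x → ε (f x) x ≢ none × ε (g x) x ≢ none) xs →
               ∀ φ → Legal φ → Outcome φ xs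
      greedy [] [] φ legal = record
        { result = φ ; legal = legal ; handled = λ () ; kept = λ _ → id ; preserve = λ _ → id }
      greedy (x ∷ xs) ((fx , gx) ∷ rest) φ legal
        with v , v∈ , sat-f , sat-g ← choose {Sat (f x)} {Sat (g x)} (sat-flex fx) (sat-flex gx) φ = record
        { result   = result
        ; legal    = legal′
        ; handled  = λ { (now absorbs kept) → kept′ kept (absorbed absorbs) ; (later h) → handled h }
        ; kept     = λ where
            (inj₁ ε≡none ∷ kept) sat  → kept′ kept (sat-indep ε≡none φ v sat)
            (inj₂ absorbs ∷ kept) _   → kept′ kept (absorbed absorbs)
        ; preserve = λ { (indep ∷ indeps) p → preserve indeps (indep φ v p) }
        }
        where
        open Outcome (greedy xs rest (φ [ x ≔ v ]) (legal-update legal v∈))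
          renaming (legal to legal′; kept to kept′)

        absorbed : ∀ {e} → Absorbs e x → Sat e (φ [ x ≔ v ])
        absorbed (inj₁ refl) = sat-f
        absorbed (inj₂ refl) = sat-g

only-left : ∀ {A B C : Set} → A ⊎ B ⊎ C → ¬ B → ¬ C → A
only-left (inj₁ a)        _  _  = a
only-left (inj₂ (inj₁ b)) ¬b _  = contradiction b ¬b
only-left (inj₂ (inj₂ c)) _  ¬c = contradiction c ¬c

-- Cyclic shifts of indices.

module CyclicShift (m : ℕ) where

  n : ℕ
  n = suc m

  toℕ-shift : ∀ k (i : Fin n) → toℕ (shift k i) ≡ (toℕ i ℕ.+ k) % n
  toℕ-shift k i = Fin.toℕ-fromℕ< (m%n<n (toℕ i ℕ.+ k) n)

  toℕ-shift-< : ∀ k (i : Fin n) → toℕ i ℕ.+ k ℕ.< n → toℕ (shift k i) ≡ toℕ i ℕ.+ k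
  toℕ-shift-< k i i+k<n = trans (toℕ-shift k i) (m<n⇒m%n≡m i+k<n)

  -- For `k ≤ n` the sum wraps around only once. Adding `n` on the left avoids truncated
  -- subtraction.
  toℕ-shift-≥ : ∀ k (i : Fin n) → k ℕ.≤ n → n ℕ.≤ toℕ i ℕ.+ k → toℕ (shift k i) ℕ.+ n ≡ toℕ i ℕ.+ k
  toℕ-shift-≥ k i k≤n n≤i+k = begin
    toℕ (shift k i) ℕ.+ n             ≡⟨ cong (ℕ._+ n) (toℕ-shift k i) ⟩
    (toℕ i ℕ.+ k) % n ℕ.+ n           ≡⟨ cong (ℕ._+ n) (m≤n⇒[n∸m]%m≡n%m n≤i+k) ⟨
    (toℕ i ℕ.+ k ℕ.∸ n) % n ℕ.+ n     ≡⟨ cong (ℕ._+ n) (m<n⇒m%n≡m small) ⟩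
    (toℕ i ℕ.+ k ℕ.∸ n) ℕ.+ n         ≡⟨ ℕ.m∸n+n≡m n≤i+k ⟩
    toℕ i ℕ.+ k                       ∎
    where
    open ≡-Reasoning
    small : toℕ i ℕ.+ k ℕ.∸ n ℕ.< n
    small = ℕ.+-cancelʳ-< n _ _
      (subst (ℕ._< n ℕ.+ n) (sym (ℕ.m∸n+n≡m n≤i+k)) (ℕ.+-mono-<-≤ (Fin.toℕ<n i) k≤n))

  shift-shift : ∀ a b (i : Fin n) → shift b (shift a i) ≡ shift (a ℕ.+ b) i
  shift-shift a b i = Fin.toℕ-injective (begin
    toℕ (shift b (shift a i))                      ≡⟨ toℕ-shift b (shift a i) ⟩
    (toℕ (shift a i) ℕ.+ b) % n                    ≡⟨ cong (λ k → (k ℕ.+ b) % n) (toℕ-shift a i) ⟩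
    ((toℕ i ℕ.+ a) % n ℕ.+ b) % n                  ≡⟨ %-distribˡ-+ ((toℕ i ℕ.+ a) % n) b n ⟩
    ((toℕ i ℕ.+ a) % n % n ℕ.+ b % n) % n
      ≡⟨ cong (λ k → (k ℕ.+ b % n) % n) (m%n%n≡m%n (toℕ i ℕ.+ a) n) ⟩
    ((toℕ i ℕ.+ a) % n ℕ.+ b % n) % n              ≡⟨ %-distribˡ-+ (toℕ i ℕ.+ a) b n ⟨
    (toℕ i ℕ.+ a ℕ.+ b) % n                        ≡⟨ cong (_% n) (ℕ.+-assoc (toℕ i) a b) ⟩
    (toℕ i ℕ.+ (a ℕ.+ b)) % n                      ≡⟨ toℕ-shift (a ℕ.+ b) i ⟨
    toℕ (shift (a ℕ.+ b) i)                        ∎)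
    where open ≡-Reasoning

  shift-n : ∀ (i : Fin n) → shift n i ≡ i
  shift-n i = Fin.toℕ-injective (trans (toℕ-shift n i)
    (trans ([m+n]%n≡m%n (toℕ i) n) (m<n⇒m%n≡m (Fin.toℕ<n i))))

  shift-inverse : ∀ a b → a ℕ.+ b ≡ n → ∀ (i : Fin n) → shift b (shift a i) ≡ i
  shift-inverse a b a+b≡n i =
    trans (shift-shift a b i) (trans (cong (λ k → shift k i) a+b≡n) (shift-n i))

  shift-injective : ∀ {a} → a ℕ.≤ n → ∀ {i j : Fin n} → shift a i ≡ shift a j → i ≡ j
  shift-injective {a} a≤n {i} {j} eq = begin
    i                             ≡⟨ shift-inverse a (n ℕ.∸ a) (ℕ.m+[n∸m]≡n a≤n) i ⟨
    shift (n ℕ.∸ a) (shift a i)   ≡⟨ cong (shift (n ℕ.∸ a)) eq ⟩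
    shift (n ℕ.∸ a) (shift a j)   ≡⟨ shift-inverse a (n ℕ.∸ a) (ℕ.m+[n∸m]≡n a≤n) j ⟩
    j                             ∎
    where open ≡-Reasoning

  -- Without wrapping the index grows by `k`; with wrapping, a fixed point would force `k = n`.
  shift-free : ∀ {k} → 0 ℕ.< k → k ℕ.< n → ∀ (i : Fin n) → shift k i ≢ i
  shift-free {k} 0<k k<n i eq with toℕ i ℕ.+ k ℕ.<? n
  ... | yes i+k<n = ℕ.<⇒≢ (ℕ.m<m+n (toℕ i) 0<k) (trans (cong toℕ (sym eq)) (toℕ-shift-< k i i+k<n))
  ... | no  i+k≮n = ℕ.<⇒≢ k<n (sym (ℕ.+-cancelˡ-≡ (toℕ i) n k
    (trans (cong (ℕ._+ n) (cong toℕ (sym eq))) (toℕ-shift-≥ k i (ℕ.<⇒≤ k<n) (ℕ.≮⇒≥ i+k≮n)))))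

-- The edge list and its freedom from repetitions.

outer-injective : ∀ {n} {i j : Fin n} → outer i ≡ outer j → i ≡ j
outer-injective refl = refl

spoke-injective : ∀ {n} {i j : Fin n} → spoke i ≡ spoke j → i ≡ j
spoke-injective refl = refl

inner-injective : ∀ {n} {i j : Fin n} → inner i ≡ inner j → i ≡ j
inner-injective refl = refl

_≟ᴱ_ : ∀ {n} → DecidableEquality (Edge n)
outer i ≟ᴱ outer j = map′ (cong outer) outer-injective (i Fin.≟ j)
outer i ≟ᴱ spoke j = no λ ()
outer i ≟ᴱ inner j = no λ ()
spoke i ≟ᴱ outer j = no λ ()
spoke i ≟ᴱ spoke j = map′ (cong spoke) spoke-injective (i Fin.≟ j)
spoke i ≟ᴱ inner j = no λ ()
inner i ≟ᴱ outer j = no λ ()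
inner i ≟ᴱ spoke j = no λ ()
inner i ≟ᴱ inner j = map′ (cong inner) inner-injective (i Fin.≟ j)

-- Makes each weight enter a vertex sum at most once, so that changing it moves the sum by exactly
-- one increment.
edges-unique : ∀ n t → Unique (edges n t)
edges-unique n t =
  Unique.++⁺ (Unique.map⁺ outer-injective (Unique.allFin⁺ n))
    (Unique.++⁺ (Unique.map⁺ spoke-injective (Unique.allFin⁺ n))
      (Unique.map⁺ inner-injective
        (Unique.filter⁺ (λ i → innerKept n t i Bool.≟ true) (Unique.allFin⁺ n)))
      spoke≠inner)
    outer≠rest
  where
  inners : List (Fin n)
  inners = filter (λ i → innerKept n t i Bool.≟ true) (allFin n)

  spoke≠inner : ∀ {e} → ¬ (e ∈ map spoke (allFin n) × e ∈ map inner inners)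
  spoke≠inner (e∈ , e∈′) with ∈-map⁻ spoke e∈ | ∈-map⁻ inner e∈′
  ... | _ , _ , refl | _ , _ , ()

  outer≠rest : ∀ {e} → ¬ (e ∈ map outer (allFin n) × e ∈ map spoke (allFin n) ++ map inner inners)
  outer≠rest (e∈ , e∈′) with ∈-map⁻ outer e∈ | ∈-++⁻ (map spoke (allFin n)) e∈′
  ... | _ , _ , refl | inj₁ e∈spokes with ∈-map⁻ spoke e∈spokes
  ... | _ , _ , ()
  outer≠rest (e∈ , e∈′) | _ , _ , refl | inj₂ e∈inners with ∈-map⁻ inner e∈inners
  ... | _ , _ , ()

-- Incidence, vertex sums and their differences.

module Incidence (n t : ℕ) where
  open DecMembership (_≟ᴱ_ {n}) using () renaming (_∈?_ to _∈ᴱ?_)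

  abstract
    -- Incidence is membership in the very list that `vertexSum` adds up, so an inner edge dropped
    -- when `2t = n` is incident with no vertex.
    Inc : Vertex n → Edge n → Set
    Inc w x = x ∈ filter (incident? t w) (edges n t)

    inc? : ∀ w x → Dec (Inc w x)
    inc? w x = x ∈ᴱ? filter (incident? t w) (edges n t)

    inc⇒∈ : ∀ {w x} → Inc w x → x ∈ filter (incident? t w) (edges n t)
    inc⇒∈ = id

    ∈⇒inc : ∀ {w x} → x ∈ filter (incident? t w) (edges n t) → Inc w x
    ∈⇒inc = id

  inc⁺ : ∀ {w x} → x ∈ edges n t → w ≡ proj₁ (endpoints t x) ⊎ w ≡ proj₂ (endpoints t x) → Inc w x
  inc⁺ {w} x∈ ends = ∈⇒inc (∈-filter⁺ (incident? t w) x∈ ends)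

  inc⁻ : ∀ {w x} → Inc w x → w ≡ proj₁ (endpoints t x) ⊎ w ≡ proj₂ (endpoints t x)
  inc⁻ {w} {x} inc = proj₂ (∈-filter⁻ (incident? t w) {x} {edges n t} (inc⇒∈ inc))

  outer∈ : ∀ i → outer i ∈ edges n t
  outer∈ i = ∈-++⁺ˡ (∈-map⁺ outer (∈-allFin i))

  spoke∈ : ∀ i → spoke i ∈ edges n t
  spoke∈ i = ∈-++⁺ʳ (map outer (allFin n)) (∈-++⁺ˡ (∈-map⁺ spoke (∈-allFin i)))

  inner∈ : ∀ {i} → innerKept n t i ≡ true → inner i ∈ edges n t
  inner∈ {i} kept = ∈-++⁺ʳ (map outer (allFin n)) (∈-++⁺ʳ (map spoke (allFin n))
    (∈-map⁺ inner (∈-filter⁺ (λ i → innerKept n t i Bool.≟ true) (∈-allFin i) kept)))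

  coefficient : Bool → Bool → Coefficient
  coefficient true  true  = none
  coefficient true  false = plus
  coefficient false true  = minus
  coefficient false false = none

  abstract
    -- The coefficient of the weight `x` in the difference of the sums at the two ends of `e`; a
    -- weight incident with both ends cancels.
    ε : Edge n → Edge n → Coefficient
    ε e x = coefficient (does (inc? (proj₁ (endpoints t e)) x)) (does (inc? (proj₂ (endpoints t e)) x))

    ε-plus : ∀ {e x} → Inc (proj₁ (endpoints t e)) x → ¬ Inc (proj₂ (endpoints t e)) x → ε e x ≡ plus
    ε-plus {e} {x} yes₁ no₂ rewrite dec-true (inc? _ x) yes₁ | dec-false (inc? _ x) no₂ = refl

    ε-minus : ∀ {e x} → ¬ Inc (proj₁ (endpoints t e)) x → Inc (proj₂ (endpoints t e)) x → ε e x ≡ minus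
    ε-minus {e} {x} no₁ yes₂ rewrite dec-false (inc? _ x) no₁ | dec-true (inc? _ x) yes₂ = refl

    ε-neither : ∀ {e x} → ¬ Inc (proj₁ (endpoints t e)) x → ¬ Inc (proj₂ (endpoints t e)) x → ε e x ≡ none
    ε-neither {e} {x} no₁ no₂ rewrite dec-false (inc? _ x) no₁ | dec-false (inc? _ x) no₂ = refl

    ε-both : ∀ {e x} → Inc (proj₁ (endpoints t e)) x → Inc (proj₂ (endpoints t e)) x → ε e x ≡ none
    ε-both {e} {x} yes₁ yes₂ rewrite dec-true (inc? _ x) yes₁ | dec-true (inc? _ x) yes₂ = refl

  module Weights (R : CompleteOrderedField) (LV : Vertex n → CompleteOrderedField.Carrier R)
                 (LE : Edge n → ThreeSet R) where
    open CompleteOrderedField R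
    open OrderedField R
    open ListChoice R _≟ᴱ_ LE public

    total : Assignment → List (Edge n) → Carrier
    total φ xs = foldr _+_ 0# (map φ xs)

    total-∉ : ∀ φ {x} v {xs} → x ∉ xs → total (φ [ x ≔ v ]) xs ≡ total φ xs
    total-∉ φ v {[]}     x∉ = refl
    total-∉ φ v {y ∷ xs} x∉ =
      cong₂ _+_ (update-other φ v (λ y≡x → x∉ (here (sym y≡x)))) (total-∉ φ v (x∉ ∘ there))

    total-∈ : ∀ φ {x} v {xs} → Unique xs → x ∈ xs → total (φ [ x ≔ v ]) xs ≡ total φ xs + (v - φ x)
    total-∈ φ {x} v {_ ∷ xs} (x≢xs ∷ _) (here refl) = begin
      (φ [ x ≔ v ]) x + total (φ [ x ≔ v ]) xs
        ≡⟨ cong₂ _+_ (update-same φ x v) (total-∉ φ v λ x∈ → All.lookup x≢xs x∈ refl) ⟩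
      v + total φ xs                     ≡⟨ cong (_+ total φ xs) x+[y-x]≡y ⟨
      φ x + (v - φ x) + total φ xs       ≡⟨ xy∙z≈xz∙y (φ x) (v - φ x) (total φ xs) ⟩
      φ x + total φ xs + (v - φ x)       ∎
      where
      open ≡-Reasoning
      x+[y-x]≡y : φ x + (v - φ x) ≡ v
      x+[y-x]≡y = trans (sym (+-assoc (φ x) v (- φ x))) (xyx⁻¹≈y (φ x) v)
    total-∈ φ {x} v {y ∷ xs} (y≢xs ∷ xs!) (there x∈) = begin
      (φ [ x ≔ v ]) y + total (φ [ x ≔ v ]) xs
        ≡⟨ cong₂ _+_ (update-other φ v (All.lookup y≢xs x∈)) (total-∈ φ v xs! x∈) ⟩
      φ y + (total φ xs + (v - φ x))     ≡⟨ +-assoc _ _ _ ⟨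
      φ y + total φ xs + (v - φ x)       ∎
      where open ≡-Reasoning

    S : Assignment → Vertex n → Carrier
    S = vertexSum R n t LV

    S-out : ∀ φ {x} v {w} → ¬ Inc w x → S (φ [ x ≔ v ]) w ≡ S φ w
    S-out φ v {w} ¬inc = cong (LV w +_) (total-∉ φ v (¬inc ∘ ∈⇒inc))

    S-in : ∀ φ {x} v {w} → Inc w x → S (φ [ x ≔ v ]) w ≡ S φ w + (v - φ x)
    S-in φ v {w} inc = trans
      (cong (LV w +_) (total-∈ φ v (Unique.filter⁺ (incident? t w) (edges-unique n t)) (inc⇒∈ inc)))
      (sym (+-assoc _ _ _))

    abstract
      D : Edge n → Assignment → Carrier
      D e φ = S φ (proj₁ (endpoints t e)) - S φ (proj₂ (endpoints t e))

      D-update : ∀ e φ x v → D e (φ [ x ≔ v ]) ≡ D e φ + ε e x · (v - φ x)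
      D-update e φ x v with inc? (proj₁ (endpoints t e)) x | inc? (proj₂ (endpoints t e)) x
      ... | yes inc₁ | yes inc₂ = begin
        S (φ [ x ≔ v ]) _ - S (φ [ x ≔ v ]) _  ≡⟨ cong₂ _-_ (S-in φ v inc₁) (S-in φ v inc₂) ⟩
        (S φ _ + (v - φ x)) - (S φ _ + (v - φ x))  ≡⟨ [x+z]-[y+z]≡x-y _ _ _ ⟩
        D e φ                                  ≡⟨ +-identityʳ (D e φ) ⟨
        D e φ + 0#                             ∎
        where open ≡-Reasoning
      ... | yes inc₁ | no ¬inc₂ = begin
        S (φ [ x ≔ v ]) _ - S (φ [ x ≔ v ]) _  ≡⟨ cong₂ _-_ (S-in φ v inc₁) (S-out φ v ¬inc₂) ⟩
        (S φ _ + (v - φ x)) - S φ _            ≡⟨ xy∙z≈xz∙y _ _ _ ⟩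
        D e φ + (v - φ x)                      ∎
        where open ≡-Reasoning
      ... | no ¬inc₁ | yes inc₂ = begin
        S (φ [ x ≔ v ]) _ - S (φ [ x ≔ v ]) _  ≡⟨ cong₂ _-_ (S-out φ v ¬inc₁) (S-in φ v inc₂) ⟩
        S φ _ - (S φ _ + (v - φ x))            ≡⟨ cong (S φ _ +_) (⁻¹-∙-comm _ _) ⟨
        S φ _ + (- S φ _ - (v - φ x))          ≡⟨ +-assoc _ _ _ ⟨
        D e φ - (v - φ x)                      ∎
        where open ≡-Reasoning
      ... | no ¬inc₁ | no ¬inc₂ = begin
        S (φ [ x ≔ v ]) _ - S (φ [ x ≔ v ]) _  ≡⟨ cong₂ _-_ (S-out φ v ¬inc₁) (S-out φ v ¬inc₂) ⟩
        D e φ                                  ≡⟨ +-identityʳ (D e φ) ⟨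
        D e φ + 0#                             ∎
        where open ≡-Reasoning

      sums-differ : ∀ {e φ} → D e φ ≢ 0# → S φ (proj₁ (endpoints t e)) ≢ S φ (proj₂ (endpoints t e))
      sums-differ {e} {φ} D≢0 eq =
        D≢0 (trans (cong (_- S φ (proj₂ (endpoints t e))) eq) (+-inverseʳ _))

    open Affine D ε D-update public

    -- An arbitrary legal start. When `2t ≠ n`, the inner weights other than those indexed 0, 1 and
    -- -t keep these values to the end.
    initial : Assignment
    initial e = ThreeSet.a (LE e)

    initial-legal : Legal initial
    initial-legal e = inj₁ refl

-- Which weights each condition of P(n,t) depends on.

module Petersen
  (m t : ℕ) (3≤n : 3 ℕ.≤ suc m) (1≤t : 1 ℕ.≤ t) (2t≤n : t ℕ.+ t ℕ.≤ suc m)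
  where
  open CyclicShift m
  open Incidence n t

  next prev : Fin n → Fin n
  next = shift 1
  prev = shift m

  first : Fin n
  first = next zero

  t<n : t ℕ.< n
  t<n = ℕ.<-≤-trans (ℕ.m<m+n t 1≤t) 2t≤n

  next-prev : ∀ i → next (prev i) ≡ i
  next-prev = shift-inverse m 1 (ℕ.+-comm m 1)

  prev-next : ∀ i → prev (next i) ≡ i
  prev-next = shift-inverse 1 m refl

  next-injective : ∀ {i j} → next i ≡ next j → i ≡ j
  next-injective = shift-injective (s≤s z≤n)

  next≢ : ∀ i → next i ≢ i
  next≢ = shift-free (s≤s z≤n) (ℕ.<-trans (s≤s (s≤s z≤n)) 3≤n)

  next²≢ : ∀ i → next (next i) ≢ i
  next²≢ i eq = shift-free (s≤s z≤n) 3≤n i (trans (sym (shift-shift 1 1 i)) eq)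

  toℕ-next : ∀ i → next i ≢ zero → toℕ (next i) ≡ suc (toℕ i)
  toℕ-next i next≢0 with toℕ i ℕ.+ 1 ℕ.<? n
  ... | yes i+1<n = trans (toℕ-shift-< 1 i i+1<n) (ℕ.+-comm (toℕ i) 1)
  ... | no  i+1≮n = contradiction (Fin.toℕ-injective (ℕ.n≤0⇒n≡0 (ℕ.+-cancelʳ-≤ n _ 0 small))) next≢0
    where
    small : toℕ (next i) ℕ.+ n ℕ.≤ n
    small = ℕ.≤-trans (ℕ.≤-reflexive (toℕ-shift-≥ 1 i (s≤s z≤n) (ℕ.≮⇒≥ i+1≮n)))
      (ℕ.≤-trans (ℕ.≤-reflexive (ℕ.+-comm (toℕ i) 1)) (Fin.toℕ<n i))

  toℕ-first : toℕ first ≡ 1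
  toℕ-first = toℕ-next zero (next≢ zero)

  shift-t≢ : ∀ i → shift t i ≢ i
  shift-t≢ = shift-free 1≤t t<n

  u-outer⁻ : ∀ {i j} → Inc (false , i) (outer j) → i ≡ j ⊎ i ≡ next j
  u-outer⁻ = Sum.map (cong proj₂) (cong proj₂) ∘ inc⁻

  v-outer⁻ : ∀ {i j} → ¬ Inc (true , i) (outer j)
  v-outer⁻ inc with inc⁻ inc
  ... | inj₁ ()
  ... | inj₂ ()

  u-spoke⁻ : ∀ {i j} → Inc (false , i) (spoke j) → i ≡ j
  u-spoke⁻ inc with inc⁻ inc
  ... | inj₁ refl = refl

  v-spoke⁻ : ∀ {i j} → Inc (true , i) (spoke j) → i ≡ j
  v-spoke⁻ inc with inc⁻ inc
  ... | inj₂ refl = refl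

  u-inner⁻ : ∀ {i j} → ¬ Inc (false , i) (inner j)
  u-inner⁻ inc with inc⁻ inc
  ... | inj₁ ()
  ... | inj₂ ()

  v-inner⁻ : ∀ {i j} → Inc (true , i) (inner j) → i ≡ j ⊎ i ≡ shift t j
  v-inner⁻ = Sum.map (cong proj₂) (cong proj₂) ∘ inc⁻

  u-outer₁ : ∀ {i} → Inc (false , i) (outer i)
  u-outer₁ = inc⁺ (outer∈ _) (inj₁ refl)

  u-outer₂ : ∀ {i} → Inc (false , next i) (outer i)
  u-outer₂ = inc⁺ (outer∈ _) (inj₂ refl)

  u-spoke : ∀ {i} → Inc (false , i) (spoke i)
  u-spoke = inc⁺ (spoke∈ _) (inj₁ refl)

  v-spoke : ∀ {i} → Inc (true , i) (spoke i)
  v-spoke = inc⁺ (spoke∈ _) (inj₂ refl)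

  -- Lemmas of this shape list the only indices where a coefficient can be nonzero. The weight of
  -- the edge `outer i` itself is counted at both ends and cancels.
  ε-outer-outer : ∀ i l → ε (outer i) (outer l) ≡ none ⊎ i ≡ next l ⊎ l ≡ next i
  ε-outer-outer i l with i Fin.≟ next l | l Fin.≟ next i | i Fin.≟ l
  ... | yes i≡ | _      | _        = inj₂ (inj₁ i≡)
  ... | no _   | yes l≡ | _        = inj₂ (inj₂ l≡)
  ... | no _   | no _   | yes refl = inj₁ (ε-both u-outer₁ u-outer₂)
  ... | no i≢  | no l≢  | no i≢l   = inj₁ (ε-neither
    ([ i≢l , i≢ ]′ ∘ u-outer⁻) ([ l≢ ∘ sym , i≢l ∘ next-injective ]′ ∘ u-outer⁻))

  ε-outer-spoke : ∀ i l → ε (outer i) (spoke l) ≡ none ⊎ i ≡ l ⊎ next i ≡ l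
  ε-outer-spoke i l with i Fin.≟ l | next i Fin.≟ l
  ... | yes i≡ | _      = inj₂ (inj₁ i≡)
  ... | no _   | yes i≡ = inj₂ (inj₂ i≡)
  ... | no i≢  | no i≢′ = inj₁ (ε-neither (i≢ ∘ u-spoke⁻) (i≢′ ∘ u-spoke⁻))

  ε-outer-inner : ∀ i l → ε (outer i) (inner l) ≡ none
  ε-outer-inner i l = ε-neither u-inner⁻ u-inner⁻

  ε-spoke-outer : ∀ i l → ε (spoke i) (outer l) ≡ none ⊎ i ≡ l ⊎ i ≡ next l
  ε-spoke-outer i l with i Fin.≟ l | i Fin.≟ next l
  ... | yes i≡ | _      = inj₂ (inj₁ i≡)
  ... | no _   | yes i≡ = inj₂ (inj₂ i≡)
  ... | no i≢  | no i≢′ = inj₁ (ε-neither ([ i≢ , i≢′ ]′ ∘ u-outer⁻) v-outer⁻)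

  ε-spoke-spoke : ∀ i l → ε (spoke i) (spoke l) ≡ none
  ε-spoke-spoke i l with i Fin.≟ l
  ... | yes refl = ε-both u-spoke v-spoke
  ... | no  i≢l  = ε-neither (i≢l ∘ u-spoke⁻) (i≢l ∘ v-spoke⁻)

  ε-spoke-inner : ∀ i l → ε (spoke i) (inner l) ≡ none ⊎ i ≡ l ⊎ i ≡ shift t l
  ε-spoke-inner i l with i Fin.≟ l | i Fin.≟ shift t l
  ... | yes i≡ | _      = inj₂ (inj₁ i≡)
  ... | no _   | yes i≡ = inj₂ (inj₂ i≡)
  ... | no i≢  | no i≢′ = inj₁ (ε-neither u-inner⁻ ([ i≢ , i≢′ ]′ ∘ v-inner⁻))

  ε-inner-outer : ∀ i l → ε (inner i) (outer l) ≡ none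
  ε-inner-outer i l = ε-neither v-outer⁻ v-outer⁻

  ε-inner-spoke : ∀ i l → ε (inner i) (spoke l) ≡ none ⊎ i ≡ l ⊎ shift t i ≡ l
  ε-inner-spoke i l with i Fin.≟ l | shift t i Fin.≟ l
  ... | yes i≡ | _      = inj₂ (inj₁ i≡)
  ... | no _   | yes i≡ = inj₂ (inj₂ i≡)
  ... | no i≢  | no i≢′ = inj₁ (ε-neither (i≢ ∘ v-spoke⁻) (i≢′ ∘ v-spoke⁻))

  plus≢none : ∀ {c} → c ≡ plus → c ≢ none
  plus≢none refl ()

  minus≢none : ∀ {c} → c ≡ minus → c ≢ none
  minus≢none refl ()

  ε-outer-next : ∀ i → ε (outer i) (outer (next i)) ≢ none
  ε-outer-next i = minus≢none
    (ε-minus ([ next≢ i ∘ sym , next²≢ i ∘ sym ]′ ∘ u-outer⁻) u-outer₁)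

  ε-outer-prev : ∀ i → ε (outer (next i)) (outer i) ≢ none
  ε-outer-prev i = plus≢none
    (ε-plus u-outer₂ ([ next²≢ i , next≢ (next i) ]′ ∘ u-outer⁻))

  ε-outer-spoke₁ : ∀ i → ε (outer i) (spoke i) ≢ none
  ε-outer-spoke₁ i = plus≢none (ε-plus u-spoke (next≢ i ∘ u-spoke⁻))

  ε-outer-spoke₂ : ∀ i → ε (outer i) (spoke (next i)) ≢ none
  ε-outer-spoke₂ i = minus≢none (ε-minus (next≢ i ∘ sym ∘ u-spoke⁻) u-spoke)

  ε-spoke-outer₁ : ∀ i → ε (spoke i) (outer i) ≢ none
  ε-spoke-outer₁ i = plus≢none (ε-plus u-outer₁ v-outer⁻)

  ε-inner-spoke₁ : ∀ i → ε (inner i) (spoke i) ≡ plus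
  ε-inner-spoke₁ i = ε-plus v-spoke (shift-t≢ i ∘ v-spoke⁻)

  ε-inner-spoke₂ : ∀ i → ε (inner i) (spoke (shift t i)) ≡ minus
  ε-inner-spoke₂ i = ε-minus (shift-t≢ i ∘ sym ∘ v-spoke⁻) v-spoke

  InnerKept : Fin n → Set
  InnerKept i = innerKept n t i ≡ true

  v-inner₁ : ∀ {i} → InnerKept i → Inc (true , i) (inner i)
  v-inner₁ kept = inc⁺ (inner∈ kept) (inj₁ refl)

  v-inner₂ : ∀ {i} → InnerKept i → Inc (true , shift t i) (inner i)
  v-inner₂ kept = inc⁺ (inner∈ kept) (inj₂ refl)

  ε-spoke-inner₁ : ∀ {i} → InnerKept i → ε (spoke i) (inner i) ≢ none
  ε-spoke-inner₁ kept = minus≢none (ε-minus u-inner⁻ (v-inner₁ kept))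

  ε-spoke-inner₂ : ∀ {i} → InnerKept i → ε (spoke (shift t i)) (inner i) ≢ none
  ε-spoke-inner₂ kept = minus≢none (ε-minus u-inner⁻ (v-inner₂ kept))

  ε-inner-self : ∀ {i} → InnerKept i → ε (inner i) (inner i) ≡ none
  ε-inner-self kept = ε-both (v-inner₁ kept) (v-inner₂ kept)

  module _ (R : CompleteOrderedField) (LV : Vertex n → CompleteOrderedField.Carrier R)
           (LE : Edge n → ThreeSet R) where
    open OrderedField R using (_∈₃_)
    open Weights R LV LE

    Solution : Set
    Solution = ∃ λ φ → Legal φ × (∀ e → Sat e φ)

    -- The case n = 2t: spokes, then outer edges, then inner edges.

    module Antipodal (t+t≡n : t ℕ.+ t ≡ n) where

      -- Here `inner i` and `inner (shift t i)` name one edge in its two orientations; a spoke is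
      -- charged with both forms of the condition.
      f g : Edge n → Edge n
      f (outer i) = outer (prev i)
      f (spoke i) = inner i
      f (inner i) = spoke i
      g (outer i) = outer (next i)
      g (spoke i) = inner (shift t i)
      g (inner i) = spoke (shift t i)

      open Greedy f g

      shift-t² : ∀ i → shift t (shift t i) ≡ i
      shift-t² = shift-inverse t t t+t≡n

      kept? : (i : Fin n) → Dec (InnerKept i)
      kept? i = innerKept n t i Bool.≟ true

      kept-half : ∀ {i} → toℕ i ℕ.< t → InnerKept i
      kept-half i<t = trans
        (cong (not (t ℕ.+ t ℕ.≡ᵇ n) ∨_) (Equivalence.to Bool.T-≡ (ℕ.<⇒<ᵇ i<t))) (Bool.∨-zeroʳ _)

      -- The inner edges form a perfect matching, so a kept inner weight meets both ends of an inner
      -- condition or neither.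
      ε-inner-inner : ∀ i {l} → InnerKept l → ε (inner i) (inner l) ≡ none
      ε-inner-inner i {l} kept with i Fin.≟ l | i Fin.≟ shift t l
      ... | yes refl | _        = ε-inner-self kept
      ... | no _     | yes refl = ε-both (v-inner₂ kept)
        (subst (λ j → Inc (true , j) (inner l)) (sym (shift-t² l)) (v-inner₁ kept))
      ... | no i≢l   | no i≢l+t = ε-neither ([ i≢l , i≢l+t ]′ ∘ v-inner⁻)
        ([ (λ eq → i≢l+t (trans (sym (shift-t² i)) (cong (shift t) eq)))
         , i≢l ∘ shift-injective (ℕ.<⇒≤ t<n) ]′ ∘ v-inner⁻)

      spokes outers inners : List (Edge n)
      spokes = map spoke (allFin n)
      outers = map outer (allFin n)
      inners = map inner (filter kept? (allFin n))

      every : ∀ {P : Edge n → Set} (c : Fin n → Edge n) → (∀ i → P (c i)) → All P (map c (allFin n))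
      every c p = All.map⁺ (All.tabulate⁺ p)

      every-inner : ∀ {P : Edge n → Set} → (∀ {i} → InnerKept i → P (inner i)) → All P inners
      every-inner p = All.map⁺ (All.map p (All.all-filter kept? (allFin n)))

      flexible : All (λ x → ε (f x) x ≢ none × ε (g x) x ≢ none) (spokes ++ outers ++ inners)
      flexible =
        All.++⁺ (every spoke λ i →
                   plus≢none (ε-inner-spoke₁ i) ,
                   subst (λ j → ε (inner (shift t i)) (spoke j) ≢ none) (shift-t² i)
                     (minus≢none (ε-inner-spoke₂ (shift t i))))
        (All.++⁺ (every outer λ i →
                   subst (λ j → ε (outer (prev i)) (outer j) ≢ none) (next-prev i) (ε-outer-next (prev i)) ,
                   ε-outer-prev i)
                 (every-inner λ kept → ε-spoke-inner₁ kept , ε-spoke-inner₂ kept))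

      open Outcome (greedy (spokes ++ outers ++ inners) flexible initial initial-legal)

      sat : ∀ e → Sat e result
      -- Every outer weight on which this condition depends also absorbs it, so the order inside
      -- `outers` is immaterial.
      sat (outer i) = handled (handled-++ʳ spokes (kept∧absorbed⇒handled
        (All.++⁺ (every outer λ l → Sum.map₂
                   [ (λ { refl → inj₂ refl }) , (λ { refl → inj₁ (cong outer (sym (prev-next i))) }) ]′
                   (ε-outer-outer i l))
                 (every-inner λ _ → inj₁ (ε-outer-inner i _)))
        (lose (∈-++⁺ˡ (∈-map⁺ outer (∈-allFin (next i)))) (inj₁ (cong outer (sym (prev-next i)))))))
      sat (spoke i) = handled (handled-++ʳ spokes (handled-++ʳ outers (kept∧absorbed⇒handled
        (every-inner λ {l} _ → Sum.map₂
          [ (λ { refl → inj₁ refl }) , (λ { refl → inj₂ refl }) ]′ (ε-spoke-inner i l))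
        absorber)))
        where
        absorbed-by : ∀ {l} → InnerKept l → Absorbs (spoke i) (inner l) → Any (Absorbs (spoke i)) inners
        absorbed-by {l} kept absorbs = lose (∈-map⁺ inner (∈-filter⁺ kept? (∈-allFin l) kept)) absorbs

        -- One of `i` and `i + t` lies below `t` modulo `n`; its inner edge is the kept
        -- representative and has the spoke at one of its ends.
        absorber : Any (Absorbs (spoke i)) inners
        absorber with toℕ i ℕ.<? t
        ... | yes i<t = absorbed-by (kept-half i<t) (inj₁ refl)
        ... | no  i≮t = absorbed-by {shift t i} (kept-half (ℕ.+-cancelʳ-< n _ _ (begin-strict
            toℕ (shift t i) ℕ.+ n  ≡⟨ toℕ-shift-≥ t i (ℕ.<⇒≤ t<n)
                                        (ℕ.≤-trans (ℕ.≤-reflexive (sym t+t≡n)) (ℕ.+-monoˡ-≤ t (ℕ.≮⇒≥ i≮t))) ⟩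
            toℕ i ℕ.+ t            <⟨ ℕ.+-monoˡ-< t (Fin.toℕ<n i) ⟩
            n ℕ.+ t                ≡⟨ ℕ.+-comm n t ⟩
            t ℕ.+ n                ∎)))
          (inj₂ (cong spoke (sym (shift-t² i))))
          where open ℕ.≤-Reasoning
      sat (inner i) = handled (kept∧absorbed⇒handled
        (All.++⁺ (every spoke λ l → Sum.map₂
                   [ (λ { refl → inj₁ refl }) , (λ { refl → inj₂ (cong inner (sym (shift-t² i))) }) ]′
                   (ε-inner-spoke i l))
        (All.++⁺ (every outer λ l → inj₁ (ε-inner-outer i l))
                 (every-inner λ kept → inj₁ (ε-inner-inner i kept))))
        (lose (∈-++⁺ˡ (∈-map⁺ spoke (∈-allFin i))) (inj₁ refl)))

      solution : Solution
      solution = result , legal , sat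

    -- The case n ≠ 2t: preparation of the exceptional conditions.

    module Generic (t+t≢n : t ℕ.+ t ≢ n) where

      2t<n : t ℕ.+ t ℕ.< n
      2t<n = ℕ.≤∧≢⇒< 2t≤n t+t≢n

      shift-2t≢ : ∀ i → shift t (shift t i) ≢ i
      shift-2t≢ i eq = shift-free (ℕ.<-≤-trans 1≤t (ℕ.m≤m+n t t)) 2t<n i
        (trans (sym (shift-shift t t i)) eq)

      kept-all : ∀ i → InnerKept i
      kept-all i with (t ℕ.+ t) ℕ.≡ᵇ n in eq
      ... | false = refl
      ... | true  = contradiction (ℕ.≡ᵇ⇒≡ (t ℕ.+ t) n (Equivalence.from Bool.T-≡ eq)) t+t≢n

      ε-inner-inner₁ : ∀ i → ε (inner (shift t i)) (inner i) ≡ plus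
      ε-inner-inner₁ i = ε-plus (v-inner₂ (kept-all i))
        ([ shift-2t≢ i , shift-t≢ (shift t i) ]′ ∘ v-inner⁻)

      ε-inner-inner₂ : ∀ i → ε (inner i) (inner (shift t i)) ≡ minus
      ε-inner-inner₂ i = ε-minus
        ([ shift-t≢ i ∘ sym , shift-2t≢ i ∘ sym ]′ ∘ v-inner⁻) (v-inner₁ (kept-all (shift t i)))

      back : Fin n → Fin n
      back = shift (n ℕ.∸ t)

      shift-back : ∀ i → shift t (back i) ≡ i
      shift-back = shift-inverse (n ℕ.∸ t) t (ℕ.m∸n+n≡m (ℕ.<⇒≤ t<n))

      back-shift : ∀ i → back (shift t i) ≡ i
      back-shift = shift-inverse t (n ℕ.∸ t) (ℕ.m+[n∸m]≡n (ℕ.<⇒≤ t<n))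

      -- p and q are −t and t modulo n.
      p q : Fin n
      p = back zero
      q = shift t zero

      shift-p : shift t p ≡ zero
      shift-p = shift-back zero

      p≢zero : p ≢ zero
      p≢zero eq = shift-t≢ p (trans shift-p (sym eq))

      q≢zero : q ≢ zero
      q≢zero = shift-t≢ zero

      p≢q : p ≢ q
      p≢q eq = shift-2t≢ zero (trans (cong (shift t) (sym eq)) shift-p)

      -- Otherwise `1 + t` would be zero modulo `n`, whereas `1 + t ≤ 2t < n`.
      first≢p : first ≢ p
      first≢p eq = shift-free (s≤s z≤n) (ℕ.≤-<-trans (ℕ.+-monoˡ-≤ t 1≤t) 2t<n) zero
        (trans (sym (shift-shift 1 t zero)) (trans (cong (shift t) eq) shift-p))

      -- What must hold before the greedy run. `triangle` concerns `n = 3t`: there `inner q` joins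
      -- the inner ends of `spoke q` and `spoke p`, whose weights are both fixed by then.
      record Prepared : Set where
        field
          start    : Assignment
          legal₀   : Legal start
          vac-p    : Vacuous (inner p) (spoke zero) start
          vac-q    : Vacuous (inner zero) (spoke zero) start
          vac-1    : Vacuous (spoke first) (outer zero) start
          triangle : shift t q ≡ p → Sat (inner q) start

      Avoid-p Avoid-1 : Assignment → Set
      Avoid-p = Avoidable (inner p) (spoke p) (spoke zero)
      Avoid-1 = Avoidable (spoke first) (outer first) (outer zero)

      avoid-p-flex : ∀ {i} → ε (inner p) (inner i) ≢ none → Flex Avoid-p (inner i)
      avoid-p-flex ε≢none = avoidable-flex ε≢none (plus≢none (ε-inner-spoke₁ p)) (λ ()) (λ ())

      ε-p-zero : ε (inner p) (inner zero) ≢ none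
      ε-p-zero = subst (λ i → ε (inner p) (inner i) ≢ none) shift-p (minus≢none (ε-inner-inner₂ p))

      avoid-1-flex : Flex Avoid-1 (inner first)
      avoid-1-flex = avoidable-flex (ε-spoke-inner₁ (kept-all first)) (ε-spoke-outer₁ first) (λ ()) (λ ())

      -- The edge `inner first` can share an end with `inner p`, as it does when `n = 2t + 1`;
      -- `choose-both` accepts either alternative.
      avoid-p-first : Indep Avoid-p (inner first) ⊎ Flex Avoid-p (inner first)
      avoid-p-first with none? (ε (inner p) (inner first))
      ... | yes ε≡none = inj₁ (avoidable-indep ε≡none (λ ()) (λ ()))
      ... | no  ε≢none = inj₂ (avoid-p-flex ε≢none)

      -- The weights of `inner zero` and `inner first` make both conditions avoidable; then
      -- `spoke p` and `outer first` make them vacuous.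
      vacuous-p-1 : ∃ λ φ → Legal φ × Vacuous (inner p) (spoke zero) φ × Vacuous (spoke first) (outer zero) φ
      vacuous-p-1 =
        let (_ , legal , avoid-p , avoid-1) = choose-both {Avoid-p} {Avoid-1}
              (avoid-p-flex ε-p-zero) avoid-p-first avoid-1-flex initial-legal
        in vacuous-both (p≢zero ∘ sym ∘ spoke-injective) (next≢ zero ∘ sym ∘ outer-injective)
             (avoidable-indep (ε-spoke-spoke first p) (λ ()) (λ ())) (vacuous-indep (ε-inner-outer p first))
             legal avoid-p avoid-1

      ε-0-p : ε (inner zero) (inner p) ≡ plus
      ε-0-p = subst (λ i → ε (inner i) (inner p) ≡ plus) shift-p (ε-inner-inner₁ p)

      Avoid-q : Assignment → Set
      Avoid-q = Avoidable (inner zero) (spoke q) (spoke zero)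

      avoid-q-flex : Flex Avoid-q (inner p)
      avoid-q-flex = avoidable-flex (plus≢none ε-0-p) (minus≢none (ε-inner-spoke₂ zero)) (λ ()) (λ ())

      vacuous-q : ∀ φ → Dec (shift t q ≡ p) → ∃ λ u → ∃ λ v → u ∈₃ LE (inner p) × v ∈₃ LE (spoke q) ×
        Vacuous (inner zero) (spoke zero) (φ [ inner p ≔ u ] [ spoke q ≔ v ]) ×
        (shift t q ≡ p → Sat (inner q) (φ [ inner p ≔ u ] [ spoke q ≔ v ]))
      -- When `n = 3t`, the conditions `inner zero` and `inner q` both depend on `inner p` and
      -- `spoke q`, with opposite signs, so a single sum of increments must serve both.
      vacuous-q φ (yes shift-q) =
        let (u , v , u∈ , v∈ , vac , sat) = vacuous-sat-pair
              {inner zero} {inner q} {inner p} {spoke q} {spoke zero}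
              (plus≢none ε-0-p) (minus≢none (ε-inner-spoke₂ zero))
              (trans (subst (λ i → ε (inner q) (inner i) ≡ minus) shift-q (ε-inner-inner₂ q))
                     (cong negate (sym ε-0-p)))
              (trans (ε-inner-spoke₁ q) (cong negate (sym (ε-inner-spoke₂ zero))))
              (λ ()) (λ ()) (q≢zero ∘ sym ∘ spoke-injective) φ
        in u , v , u∈ , v∈ , vac , λ _ → sat
      vacuous-q φ (no shift-q≢) =
        let (u , v , u∈ , v∈ , vac) = vacuous-pair avoid-q-flex (q≢zero ∘ sym ∘ spoke-injective) φ
        in u , v , u∈ , v∈ , vac , λ shift-q → contradiction shift-q shift-q≢

      prepared : Prepared
      prepared =
        let (φ , legal , vac-p , vac-1) = vacuous-p-1
            (u , v , u∈ , v∈ , vac-q , triangle) = vacuous-q φ (shift t q Fin.≟ p)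
        in record
        { start    = φ [ inner p ≔ u ] [ spoke q ≔ v ]
        ; legal₀   = legal-update (legal-update legal u∈) v∈
        -- The weight of `inner p` cancels in its own condition, and `spoke q` meets neither end of
        -- that edge, so the last two choices leave it vacuous.
        ; vac-p    = vacuous-indep
            (only-left (ε-inner-spoke p q) p≢q (λ eq → q≢zero (trans (sym eq) shift-p))) _ v
            (vacuous-indep (ε-inner-self (kept-all p)) φ u vac-p)
        ; vac-q    = vac-q
        ; vac-1    = vacuous-indep (ε-spoke-spoke first q) _ v (vacuous-indep
            (only-left (ε-spoke-inner first p) first≢p (λ eq → next≢ zero (trans eq shift-p))) φ u vac-1)
        ; triangle = triangle
        }

      open Prepared prepared

      -- The case n ≠ 2t: schedule and verification.

      f g : Edge n → Edge n
      f (outer i)         = spoke i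
      f (spoke zero)      = outer zero
      f (spoke i@(suc _)) = inner i
      f (inner i)         = inner i
      g (outer zero)      = outer first
      g (outer i@(suc _)) = outer (prev i)
      g (spoke zero)      = outer (prev zero)
      g (spoke i@(suc _)) = inner (back i)
      g (inner i)         = inner i

      open Greedy f g

      -- `spoke p` and `spoke q` are fixed in `start`, and `spoke zero` is held back to the end.
      special : List (Fin n)
      special = zero ∷ p ∷ q ∷ []

      open DecMembership (Fin._≟_ {n}) using () renaming (_∈?_ to _∈ꟳ?_)

      ordinary? : ∀ i → Dec (i ∉ special)
      ordinary? i = ¬? (i ∈ꟳ? special)

      -- The bound is 2 because `outer first` is fixed in `start` and `outer zero` waits for
      -- `last-two`.
      ≥2? : (i : Fin n) → Dec (2 ℕ.≤ toℕ i)
      ≥2? i = 2 ℕ.≤? toℕ i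

      ordinary late : List (Fin n)
      ordinary = filter ordinary? (allFin n)
      late = filter ≥2? (allFin n)

      last-two schedule : List (Edge n)
      last-two = outer zero ∷ spoke zero ∷ []
      schedule = map spoke ordinary ++ map outer late ++ last-two

      every-ordinary : ∀ {P : Edge n → Set} → (∀ {i} → i ∉ special → P (spoke i)) → All P (map spoke ordinary)
      every-ordinary h = All.map⁺ (All.map h (All.all-filter ordinary? (allFin n)))

      every-late : ∀ {P : Edge n → Set} → (∀ {i} → 2 ℕ.≤ toℕ i → P (outer i)) → All P (map outer late)
      every-late h = All.map⁺ (All.map h (All.all-filter ≥2? (allFin n)))

      every : ∀ {P : Edge n → Set} → (∀ {i} → i ∉ special → P (spoke i)) →
              (∀ {i} → 2 ℕ.≤ toℕ i → P (outer i)) → P (outer zero) → P (spoke zero) → All P schedule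
      every h h′ o s = All.++⁺ (every-ordinary h) (All.++⁺ (every-late h′) (o ∷ s ∷ []))

      -- `late` is increasing, so the outer weights chosen between `outer j` and `last-two` are
      -- exactly those of larger index.
      handled-late : ∀ {e j} → 2 ℕ.≤ toℕ j → Absorbs e (outer j) →
                     (∀ {l} → toℕ j ℕ.< toℕ l → Kept e (outer l)) → All (Kept e) last-two →
                     Handled e schedule
      handled-late {e} {j} 2≤j absorbs kept-later kept-last = handled-++ʳ (map spoke ordinary)
        (go late (AllPairs.filter⁺ ≥2? (AllPairs.tabulate⁺-< id)) (∈-filter⁺ ≥2? (∈-allFin j) 2≤j))
        where
        go : ∀ js → AllPairs Fin._<_ js → j ∈ js → Handled e (map outer js ++ last-two)
        go (_ ∷ js) (j<js ∷ _)   (here refl) =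
          now absorbs (All.++⁺ (All.map⁺ (All.map kept-later j<js)) kept-last)
        go (_ ∷ js) (_ ∷ sorted) (there j∈)  = later (go js sorted j∈)

      flexible : All (λ x → ε (f x) x ≢ none × ε (g x) x ≢ none) schedule
      flexible = every spokes outers
        (ε-spoke-outer₁ zero , ε-outer-prev zero)
        (ε-outer-spoke₁ zero ,
         subst (λ i → ε (outer (prev zero)) (spoke i) ≢ none) (next-prev zero) (ε-outer-spoke₂ (prev zero)))
        where
        spokes : ∀ {i} → i ∉ special → ε (f (spoke i)) (spoke i) ≢ none × ε (g (spoke i)) (spoke i) ≢ none
        spokes {zero}      i∉ = contradiction (here refl) i∉
        spokes {i@(suc _)} i∉ = plus≢none (ε-inner-spoke₁ i) ,
          subst (λ j → ε (inner (back i)) (spoke j) ≢ none) (shift-back i) (minus≢none (ε-inner-spoke₂ (back i)))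

        outers : ∀ {i} → 2 ℕ.≤ toℕ i → ε (f (outer i)) (outer i) ≢ none × ε (g (outer i)) (outer i) ≢ none
        outers {i@(suc _)} _ = ε-spoke-outer₁ i ,
          subst (λ j → ε (outer (prev i)) (outer j) ≢ none) (next-prev i) (ε-outer-next (prev i))

      open Outcome (greedy schedule flexible start legal₀)

      late⇒≢zero : ∀ {i : Fin n} → 2 ℕ.≤ toℕ i → i ≢ zero
      late⇒≢zero () refl

      late⇒first≢ : ∀ {i} → 2 ℕ.≤ toℕ i → first ≢ i
      late⇒first≢ 2≤i refl with subst (2 ℕ.≤_) toℕ-first 2≤i
      ... | s≤s ()

      ≢0∧≢first⇒late : ∀ i → i ≢ zero → i ≢ first → 2 ℕ.≤ toℕ i
      ≢0∧≢first⇒late i i≢0 i≢1 = ℕ.≤∧≢⇒<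
        (ℕ.n≢0⇒n>0 (i≢0 ∘ Fin.toℕ-injective)) (λ 1≡i → i≢1 (Fin.toℕ-injective (trans (sym 1≡i) (sym toℕ-first))))

      absorbs-next : ∀ i → next i ≢ zero → Absorbs (outer i) (outer (next i))
      absorbs-next i next≢0 with next i in eq
      ... | zero  = contradiction refl next≢0
      ... | suc _ = inj₂ (cong outer (trans (sym (prev-next i)) (cong prev eq)))

      sat-outer : ∀ i → Dec (i ≡ zero) → Dec (next i ≡ zero) → Dec (i ≡ first) → Sat (outer i) result
      sat-outer i (yes refl) _ _ =
        handled (handled-++ʳ (map spoke ordinary) (handled-++ʳ (map outer late) (later (now (inj₁ refl) []))))
      sat-outer i (no _) (yes next≡0) _ =
        handled (handled-++ʳ (map spoke ordinary) (handled-++ʳ (map outer late)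
          (later (now (inj₂ (cong outer (trans (sym (prev-next i)) (cong prev next≡0)))) []))))
      -- At `first` the preceding outer edge is `outer zero`, which is chosen after all late weights
      -- and therefore takes the charge.
      sat-outer i (no i≢0) (no next≢0) (yes refl) =
        handled (handled-++ʳ (map spoke ordinary) (handled-++ʳ (map outer late)
          (now (inj₂ refl) (inj₁ (only-left (ε-outer-spoke first zero) i≢0 next≢0) ∷ []))))
      sat-outer i (no i≢0) (no next≢0) (no i≢1) = handled (handled-late
        (subst (2 ℕ.≤_) (sym (toℕ-next i next≢0)) (s≤s (ℕ.n≢0⇒n>0 (i≢0 ∘ Fin.toℕ-injective))))
        (absorbs-next i next≢0)
        (λ {l} next<l → inj₁ (only-left (ε-outer-outer i l)
          (λ { refl → ℕ.<-asym (ℕ.≤-reflexive (sym (toℕ-next l i≢0)))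
                               (ℕ.<-trans (ℕ.≤-reflexive (sym (toℕ-next i next≢0))) next<l) })
          (λ { refl → ℕ.<-irrefl refl next<l })))
        (inj₁ (only-left (ε-outer-outer i zero) i≢1 (next≢0 ∘ sym)) ∷
         inj₁ (only-left (ε-outer-spoke i zero) i≢0 next≢0) ∷ []))

      sat-spoke : ∀ i → Dec (i ≡ zero) → Dec (i ≡ first) → Sat (spoke i) result
      sat-spoke i (yes refl) _ = handled (handled-++ʳ (map spoke ordinary) (handled-++ʳ (map outer late)
        (now (inj₁ refl) (inj₁ (ε-spoke-spoke zero zero) ∷ []))))
      -- Among the scheduled weights only `outer zero` enters this condition, and vacuity in that
      -- weight survives its own choice.
      sat-spoke i (no _) (yes refl) = vacuous⇒sat legal (preserve (every
        (λ _ → vacuous-indep (ε-spoke-spoke first _))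
        (λ {l} 2≤l → vacuous-indep (only-left (ε-spoke-outer first l) (late⇒first≢ 2≤l)
          (late⇒≢zero 2≤l ∘ sym ∘ next-injective)))
        vacuous-indep-self
        (vacuous-indep (ε-spoke-spoke first zero))) vac-1)
      sat-spoke i (no i≢0) (no i≢1) = handled (handled-late (≢0∧≢first⇒late i i≢0 i≢1) (inj₁ refl)
        (λ {l} i<l → inj₁ (only-left (ε-spoke-outer i l)
          (λ { refl → ℕ.<-irrefl refl i<l })
          (λ { refl → ℕ.<-asym i<l (ℕ.≤-reflexive (sym (toℕ-next l i≢0))) })))
        (inj₁ (only-left (ε-spoke-outer i zero) i≢0 i≢1) ∷ inj₁ (ε-spoke-spoke i zero) ∷ []))

      -- With both ends at special indices, `spoke zero` is the only scheduled weight that can enter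
      -- the condition.
      inner-vacuous : ∀ {i} → i ∈ special → shift t i ∈ special →
        Vacuous (inner i) (spoke zero) start → Sat (inner i) result
      inner-vacuous {i} i∈ i+t∈ vac = vacuous⇒sat legal (preserve (every
        (λ {l} l∉ → vacuous-indep (only-left (ε-inner-spoke i l) (λ { refl → l∉ i∈ }) (λ { refl → l∉ i+t∈ })))
        (λ _ → vacuous-indep (ε-inner-outer i _))
        (vacuous-indep (ε-inner-outer i zero))
        vacuous-indep-self) vac)

      absorbs-spoke₁ : ∀ i → i ≢ zero → Absorbs (inner i) (spoke i)
      absorbs-spoke₁ zero    i≢0 = contradiction refl i≢0
      absorbs-spoke₁ (suc _) _   = inj₁ refl

      absorbs-spoke₂ : ∀ i → shift t i ≢ zero → Absorbs (inner i) (spoke (shift t i))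
      absorbs-spoke₂ i i+t≢0 with shift t i in eq
      ... | zero  = contradiction refl i+t≢0
      ... | suc _ = inj₂ (cong inner (trans (sym (back-shift i)) (cong back eq)))

      sat-inner : ∀ i → Dec (i ≡ zero) → Dec (i ≡ p) → Sat (inner i) result
      sat-inner i (yes refl) _          = inner-vacuous (here refl) (there (there (here refl))) vac-q
      sat-inner i (no _)     (yes refl) = inner-vacuous (there (here refl)) (here shift-p) vac-p
      sat-inner i (no i≢0)   (no i≢p)   = by-spokes (i ∈ꟳ? special) (shift t i ∈ꟳ? special)
        where
        i+t≢0 : shift t i ≢ zero
        i+t≢0 eq = i≢p (trans (sym (back-shift i)) (cong back eq))

        ε-last : ε (inner i) (spoke zero) ≡ none
        ε-last = only-left (ε-inner-spoke i zero) i≢0 i+t≢0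

        -- Every spoke on which the condition depends also absorbs it, so one ordinary spoke at
        -- either end is enough.
        kept-all-spokes : All (Kept (inner i)) schedule
        kept-all-spokes = every
          (λ {l} _ → Sum.map₂ [ (λ { refl → absorbs-spoke₁ i i≢0 }) , (λ { refl → absorbs-spoke₂ i i+t≢0 }) ]′
            (ε-inner-spoke i l))
          (λ _ → inj₁ (ε-inner-outer i _)) (inj₁ (ε-inner-outer i zero)) (inj₁ ε-last)

        spoke∈schedule : ∀ {j} → j ∉ special → spoke j ∈ schedule
        spoke∈schedule {j} j∉ = ∈-++⁺ˡ (∈-map⁺ spoke (∈-filter⁺ ordinary? (∈-allFin j) j∉))

        both-special : i ∈ special → shift t i ∈ special → Sat (inner i) result
        both-special (here i≡0) _ = contradiction i≡0 i≢0
        both-special (there (here i≡p)) _ = contradiction i≡p i≢p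
        both-special (there (there (here i≡q))) (here i+t≡0) = contradiction i+t≡0 i+t≢0
        both-special (there (there (here i≡q))) (there (there (here i+t≡q))) =
          contradiction (trans i+t≡q (sym i≡q)) (shift-t≢ i)
        -- The remaining case is `i = q` with `q + t = p` modulo `n`: the condition already holds in
        -- `start`, and no scheduled weight enters it.
        both-special i∈@(there (there (here refl))) i+t∈@(there (here q+t≡p)) = preserve (every
          (λ {l} l∉ → sat-indep (only-left (ε-inner-spoke q l) (λ { refl → l∉ i∈ }) (λ { refl → l∉ i+t∈ })))
          (λ _ → sat-indep (ε-inner-outer q _)) (sat-indep (ε-inner-outer q zero)) (sat-indep ε-last))
          (triangle q+t≡p)

        by-spokes : Dec (i ∈ special) → Dec (shift t i ∈ special) → Sat (inner i) result
        by-spokes (no i∉) _ = handled (kept∧absorbed⇒handled kept-all-spokes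
          (lose (spoke∈schedule i∉) (absorbs-spoke₁ i i≢0)))
        by-spokes (yes _) (no i+t∉) = handled (kept∧absorbed⇒handled kept-all-spokes
          (lose (spoke∈schedule i+t∉) (absorbs-spoke₂ i i+t≢0)))
        by-spokes (yes i∈) (yes i+t∈) = both-special i∈ i+t∈

      solution : Solution
      solution = result , legal , λ where
        (outer i) → sat-outer i (i Fin.≟ zero) (next i Fin.≟ zero) (i Fin.≟ first)
        (spoke i) → sat-spoke i (i Fin.≟ zero) (i Fin.≟ first)
        (inner i) → sat-inner i (i Fin.≟ zero) (i Fin.≟ p)

    solution : Solution
    solution with t ℕ.+ t ℕ.≟ n
    ... | yes t+t≡n = Antipodal.solution t+t≡n
    ... | no  t+t≢n = Generic.solution t+t≢n

open import Data.Nat using (_≤_; _+_)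

theorem3p2 : (R : CompleteOrderedField) (n t : ℕ) → 3 ≤ n → 1 ≤ t → t + t ≤ n →
    Choosable13 R n t
theorem3p2 R (suc m) t 3≤n 1≤t 2t≤n LV LE
  with φ , legal , sat ← Petersen.solution m t 3≤n 1≤t 2t≤n R LV LE
  = φ , (λ e _ → legal e) , λ e _ → sums-differ (sat e)
  where open Incidence.Weights (suc m) t R LV LE
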